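{- Let $n\ge 3$ and let $\mu$ be a partition of $n$ in the interval $[(1^n),(3,1^{n-3})]$ of the reverse lexicographic order. Then $\psi_\mu=\sum_{(1^n)\le\lambda\le\mu}p_\lambda$ is Schur-positive. Equivalently, the following are Schur-positive: (1) $\psi_{(2^k,1^{n-2k})}=\sum_{i=0}^k p_2^i p_1^{n-2i}$ for every $k\le n/2$ (and one has the recurrence $\psi_{(2^{k+1},1^{n-2(k+1)})}=\psi_{(2^k,1^{n-2k})}+p_2^{k+1}p_1^{n-2(k+1)}$ for $0\le k<n/2$); (2) $\psi_{(3,1^{n-3})}=p_3p_1^{n-3}+\psi_{(2^k,1^{n-2k})}$, where $k=\lfloor n/2\rfloor$.
   Context: Reverse lexicographic order on partitions of $n$: $\lambda>\mu$ if $\lambda_1>\mu_1$, or there is $j\geq 2$ with $\lambda_i=\mu_i$ for $i<j$ and $\lambda_j>\mu_j$; minimum $(1^n)$, maximum $(n)$. For a partition $\mu$ of $n$, $\psi_\mu=\sum_{\lambda\vdash n,\,(1^n)\le\lambda\le\mu}p_\lambda$, where $p_\lambda$ is the power sum symmetric function. Schur-positive means all coefficients in the Schur function expansion are nonnegative. Exponents in partitions denote part multiplicities. -}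

module Defs where

open import Data.Nat using (ℕ; zero; suc; _+_; _*_; _∸_; _≤ᵇ_; _<ᵇ_; _≡ᵇ_)
open import Data.Bool using (Bool; true; false; if_then_else_; _∧_; _∨_)
open import Data.List using (List; []; _∷_; _++_; map; concatMap; upTo;
  filterᵇ; reverse; null; replicate)
open import Data.Nat.ListAction using (sum)
open import Data.Product using (Σ)
open import Relation.Binary.PropositionalEquality using (_≡_)

-- Partitions are represented as lists of positive parts in weakly decreasing order.

range : ℕ → ℕ → List ℕ
range b a = if b ≤ᵇ a then map (b +_) (upTo (suc (a ∸ b))) else []

-- parts fuel m n : all partitions of n with all parts ≤ m (fuel ≥ n suffices)
parts : ℕ → ℕ → ℕ → List (List ℕ)
parts _ _ zero = [] ∷ []
parts zero _ (suc _) = []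
parts (suc f) m n@(suc _) =
  concatMap (λ k → map (k ∷_) (parts f k (n ∸ k)))
            (filterᵇ (λ k → k ≤ᵇ n) (range 1 m))

partitions : ℕ → List (List ℕ)
partitions n = parts n n n

leqRL : List ℕ → List ℕ → Bool
leqRL [] _ = true
leqRL (_ ∷ _) [] = false
leqRL (a ∷ as) (b ∷ bs) = (a <ᵇ b) ∨ ((a ≡ᵇ b) ∧ leqRL as bs)

oneN : ℕ → List ℕ
oneN n = replicate n 1

threeOnes : ℕ → List ℕ
threeOnes n = 3 ∷ replicate (n ∸ 3) 1

-- Polynomials in N variables with ℕ coefficients are represented by
-- their coefficient functions: exponent vectors (lists of length N) → ℕ.

decrs : ℕ → List ℕ → List (List ℕ)
decrs r [] = []
decrs r (a ∷ as) =
  (if r ≤ᵇ a then ((a ∸ r) ∷ as) ∷ [] else []) ++ map (a ∷_) (decrs r as)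

-- coefficient of x^α in the power sum p_lam = ∏_j (Σ_i x_i^{lam_j})
pcoef : List ℕ → List ℕ → ℕ
pcoef [] α = if sum α ≡ᵇ 0 then 1 else 0
pcoef (r ∷ lam) α = sum (map (pcoef lam) (decrs r α))

-- all κ interlacing ν: ν_{i+1} ≤ κ_i ≤ ν_i (i.e. ν/κ a horizontal strip)
interl : List ℕ → List (List ℕ)
interl [] = [] ∷ []
interl (a ∷ []) = map (λ k → k ∷ []) (range 0 a)
interl (a ∷ l@(b ∷ _)) = concatMap (λ k → map (k ∷_) (interl l)) (range b a)

dropZeros : List ℕ → List ℕ
dropZeros = filterᵇ (λ k → 1 ≤ᵇ k)

-- number of SSYT of shape ν whose largest entries, read from the largest
-- letter downward, have multiplicities given by the list (peel off
-- horizontal strips from the outside)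
kostkaRev : List ℕ → List ℕ → ℕ
kostkaRev ν [] = if null ν then 1 else 0
kostkaRev ν (a ∷ rest) =
  sum (map (λ κ → if sum ν ≡ᵇ sum κ + a then kostkaRev (dropZeros κ) rest else 0)
           (interl ν))

-- Kostka number K_{ν,α} = #SSYT of shape ν and content α
--   = coefficient of x^α in the Schur polynomial s_ν(x_1..x_N), N = length α
kostka : List ℕ → List ℕ → ℕ
kostka ν α = kostkaRev ν (reverse α)

Exps : ℕ → Set
Exps N = Σ (List ℕ) (λ α → Data.List.length α ≡ N)
  where import Data.List

psiCoef : ℕ → List ℕ → List ℕ → ℕ
psiCoef n μ α =
  sum (map (λ lam → pcoef lam α)
           (filterᵇ (λ lam → leqRL (oneN n) lam ∧ leqRL lam μ) (partitions n)))

-- A homogeneous symmetric function f of degree n (given by its coefficients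
-- in n variables, which determines it) is Schur-positive iff
-- f = Σ_{ν ⊢ n} c_ν s_ν with all c_ν ≥ 0.
SchurPositive : (n : ℕ) → (List ℕ → ℕ) → Set
SchurPositive n f =
  Σ (List ℕ → ℕ) λ c →
    (α : Exps n) → f (Σ.proj₁ α) ≡ sum (map (λ ν → c ν * kostka ν (Σ.proj₁ α)) (partitions n))
  where open import Data.Product using (proj₁)

IsPartition : ℕ → List ℕ → Set
IsPartition n μ = Σ (sum μ ≡ n) λ _ → Σ (dropZeros μ ≡ μ) λ _ → Dec≥ μ ≡ true
  where
  Dec≥ : List ℕ → Bool
  Dec≥ [] = true
  Dec≥ (a ∷ []) = true
  Dec≥ (a ∷ l@(b ∷ _)) = (b ≤ᵇ a) ∧ Dec≥ l

{-# OPTIONS --safe #-}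
-- Let h = h₂ and e = e₂, so that p₁² = h + e and p₂ = h − e.  Then
--   Σ_{i≤k} p₂^i p₁^{2(k-i)} = ((h + e)^{k+1} − (h − e)^{k+1}) / 2e
-- is a polynomial in h and e with nonnegative coefficients, and multiplication
-- by p₁, h and e preserves Schur positivity by the Pieri rules.  This settles
-- μ = (2^k, 1^{n-2k}).  For μ = (3, 1^{n-3}) write (h + e)^k = E + e O with
-- E, O polynomials in h and e² with nonnegative coefficients; the sum becomes
--   E (p₃ + 2h p₁) + O (e p₃ + e² p₁ + h² p₁)            if n = 2k + 3,
--   E (p₁p₃ + 3h² + e²) + O (e p₁p₃ + 3h e² + h³)        if n = 2k + 4,
-- and the four elements in parentheses are Schur-positive by direct expansion.
--
-- The Pieri rule for e_r is proved by splitting off one variable at a time: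
-- shapes that fail to be partitions after adding a 0/1-vector have no
-- interlacing sequences, so no admissibility conditions are needed.  The rule
-- for h₂ follows by removing the vertical strips from p₁² = h + e.
module Submission where

open import Defs
open import Data.Nat using (ℕ; zero; suc; _+_; _*_; _∸_; _≤_; _<_; z≤n; s≤s; _≤ᵇ_; _≡ᵇ_)
open import Data.Nat.Properties
open import Data.Nat.ListAction using (sum)
open import Data.Nat.ListAction.Properties using (sum-++)
open import Data.Nat.Solver using (module +-*-Solver)
open import Algebra.Properties.CommutativeSemigroup +-commutativeSemigroup using (interchange; x∙yz≈y∙xz)
open import Data.Bool using (Bool; true; false; if_then_else_; _∧_; _∨_; T)
open import Data.List using (List; []; _∷_; [_]; _++_; map; concatMap; applyUpTo; filterᵇ; reverse; replicate)
open import Data.List.Properties using (map-∘; map-++; map-applyUpTo; applyUpTo-∷ʳ; unfold-reverse; ∷-injectiveʳ)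
open import Data.List.Membership.Propositional using (_∈_; find)
open import Data.List.Membership.Propositional.Properties using (∈-map⁻; ∈-++⁻; ∈-concatMap⁻; ∈-applyUpTo⁻)
open import Data.List.Relation.Unary.Any using (here; there)
open import Data.List.Relation.Unary.All using (All; []; _∷_)
open import Data.Product using (∃; _×_; _,_; proj₁; proj₂)
open import Data.Sum using (_⊎_; inj₁; inj₂; [_,_]′)
open import Data.Unit using (tt)
open import Function using (_∘_; id)
open import Relation.Nullary using (¬_; contradiction; yes; no)
open import Relation.Binary.PropositionalEquality hiding ([_])
open ≡-Reasoning

-- No ring of symmetric functions is built. A function is given by its coefficients at exponent
-- vectors of every length, multiplication by p_r, e₂ or h₂ is an operator summing over lowered
-- vectors, and the basic identities are inductions on the number of variables. Coefficients live in
-- ℕ, so h₂ is defined as p₂ + e₂, signed expansions are kept as equations between positive sides,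
-- and subtraction becomes cancellation. `kostka` drops zeros while peeling, so the length of a
-- shape varies; `K′` keeps the length, which turns the Pieri rule into an induction on rows, at the
-- price of explicit empty rows: two for a vertical strip of size at most 2, three when a second box
-- follows the first. The passage to E and O makes the negative part of p₃ tractable: it must be
-- absorbed uniformly in k, and applying E and O to fixed elements leaves one check in each of the
-- degrees 3, 4, 5 and 6, according to the parity of n and the parity in e.

-- Finite sums

variable
  X Y : Set

∑ : (X → ℕ) → List X → ℕ
∑ f xs = sum (map f xs)

∑-++ : (f : X → ℕ) (xs ys : List X) → ∑ f (xs ++ ys) ≡ ∑ f xs + ∑ f ys
∑-++ f xs ys = trans (cong sum (map-++ f xs ys)) (sum-++ (map f xs) (map f ys))

∑-map : (f : Y → ℕ) (h : X → Y) (xs : List X) → ∑ f (map h xs) ≡ ∑ (f ∘ h) xs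
∑-map f h xs = cong sum (sym (map-∘ xs))

∑-concatMap : (f : Y → ℕ) (h : X → List Y) (xs : List X) →
  ∑ f (concatMap h xs) ≡ ∑ (λ x → ∑ f (h x)) xs
∑-concatMap f h [] = refl
∑-concatMap f h (x ∷ xs) =
  trans (∑-++ f (h x) (concatMap h xs)) (cong (∑ f (h x) +_) (∑-concatMap f h xs))

∑-cong-∈ : {f g : X → ℕ} (xs : List X) → (∀ x → x ∈ xs → f x ≡ g x) → ∑ f xs ≡ ∑ g xs
∑-cong-∈ [] e = refl
∑-cong-∈ (x ∷ xs) e = cong₂ _+_ (e x (here refl)) (∑-cong-∈ xs (λ y y∈ → e y (there y∈)))

∑-cong : {f g : X → ℕ} (xs : List X) → (∀ x → f x ≡ g x) → ∑ f xs ≡ ∑ g xs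
∑-cong xs e = ∑-cong-∈ xs (λ x _ → e x)

∑-+ : (f g : X → ℕ) (xs : List X) → ∑ (λ x → f x + g x) xs ≡ ∑ f xs + ∑ g xs
∑-+ f g [] = refl
∑-+ f g (x ∷ xs) =
  trans (cong (f x + g x +_) (∑-+ f g xs)) (interchange (f x) (g x) (∑ f xs) (∑ g xs))

∑-0 : (xs : List X) → ∑ (λ _ → 0) xs ≡ 0
∑-0 [] = refl
∑-0 (x ∷ xs) = ∑-0 xs

∑-zero : {f : X → ℕ} (xs : List X) → (∀ x → x ∈ xs → f x ≡ 0) → ∑ f xs ≡ 0
∑-zero xs e = trans (∑-cong-∈ xs e) (∑-0 xs)

∑-swap : (f : X → Y → ℕ) (xs : List X) (ys : List Y) →
  ∑ (λ x → ∑ (f x) ys) xs ≡ ∑ (λ y → ∑ (λ x → f x y) xs) ys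
∑-swap f [] ys = sym (∑-0 ys)
∑-swap f (x ∷ xs) ys =
  trans (cong (∑ (f x) ys +_) (∑-swap f xs ys)) (sym (∑-+ (f x) (λ y → ∑ (λ x′ → f x′ y) xs) ys))

∑-*ʳ : (f : X → ℕ) (c : ℕ) (xs : List X) → ∑ (λ x → f x * c) xs ≡ ∑ f xs * c
∑-*ʳ f c [] = refl
∑-*ʳ f c (x ∷ xs) = trans (cong (f x * c +_) (∑-*ʳ f c xs)) (sym (*-distribʳ-+ c (f x) (∑ f xs)))

gate : Bool → ℕ → ℕ
gate b m = if b then m else 0

∑-filterᵇ : (f : X → ℕ) (p : X → Bool) (xs : List X) →
  ∑ f (filterᵇ p xs) ≡ ∑ (λ x → gate (p x) (f x)) xs
∑-filterᵇ f p [] = refl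
∑-filterᵇ f p (x ∷ xs) with p x
... | true = cong (f x +_) (∑-filterᵇ f p xs)
... | false = ∑-filterᵇ f p xs

∑-gate : (b : Bool) (f : X → ℕ) (xs : List X) → ∑ (λ x → gate b (f x)) xs ≡ gate b (∑ f xs)
∑-gate true f xs = refl
∑-gate false f xs = ∑-0 xs

-- Boolean comparisons and their propositional counterparts

≤⇒≤ᵇ≡true : ∀ {m n} → m ≤ n → (m ≤ᵇ n) ≡ true
≤⇒≤ᵇ≡true {m} {n} m≤n with m ≤ᵇ n | ≤⇒≤ᵇ m≤n
... | true | _ = refl

>⇒≤ᵇ≡false : ∀ {m n} → n < m → (m ≤ᵇ n) ≡ false
>⇒≤ᵇ≡false {m} {n} n<m with m ≤ᵇ n in e
... | false = refl
... | true = contradiction (≤ᵇ⇒≤ m n (subst T (sym e) tt)) (<⇒≱ n<m)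

≤ᵇ≡true⇒≤ : ∀ {m n} → (m ≤ᵇ n) ≡ true → m ≤ n
≤ᵇ≡true⇒≤ {m} {n} e = ≤ᵇ⇒≤ m n (subst T (sym e) tt)

≡⇒≡ᵇ≡true : ∀ {m n} → m ≡ n → (m ≡ᵇ n) ≡ true
≡⇒≡ᵇ≡true {m} {n} m≡n with m ≡ᵇ n | ≡⇒≡ᵇ m n m≡n
... | true | _ = refl

≢⇒≡ᵇ≡false : ∀ {m n} → ¬ (m ≡ n) → (m ≡ᵇ n) ≡ false
≢⇒≡ᵇ≡false {m} {n} m≢n with m ≡ᵇ n in e
... | false = refl
... | true = contradiction (≡ᵇ⇒≡ m n (subst T (sym e) tt)) m≢n

≡ᵇ-cong-⇔ : ∀ {m n m′ n′} → (m ≡ n → m′ ≡ n′) → (m′ ≡ n′ → m ≡ n) → (m ≡ᵇ n) ≡ (m′ ≡ᵇ n′)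
≡ᵇ-cong-⇔ {m} {n} {m′} {n′} to from with m ≡ᵇ n in e | m′ ≡ᵇ n′ in e′
... | true | true = refl
... | false | false = refl
... | true | false = trans (sym (≡⇒≡ᵇ≡true (to (≡ᵇ⇒≡ m n (subst T (sym e) tt))))) e′
... | false | true = trans (sym e) (≡⇒≡ᵇ≡true (from (≡ᵇ⇒≡ m′ n′ (subst T (sym e′) tt))))

∧-true : ∀ {a b} → a ∧ b ≡ true → (a ≡ true) × (b ≡ true)
∧-true {true} {true} _ = refl , refl

∧-false : ∀ x {y} → y ≡ false → x ∧ y ≡ false
∧-false true e = e
∧-false false e = refl

-- Intervals

∑-applyUpTo-snoc : (f : ℕ → ℕ) (n : ℕ) → sum (applyUpTo f (suc n)) ≡ sum (applyUpTo f n) + f n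
∑-applyUpTo-snoc f n = trans (cong sum (sym (applyUpTo-∷ʳ f n)))
  (trans (sum-++ (applyUpTo f n) [ f n ]) (cong (sum (applyUpTo f n) +_) (+-identityʳ (f n))))

range-≤ : ∀ {b a} → b ≤ a → range b a ≡ applyUpTo (b +_) (suc (a ∸ b))
range-≤ {b} {a} b≤a rewrite ≤⇒≤ᵇ≡true b≤a = map-applyUpTo id (b +_) (suc (a ∸ b))

range-> : ∀ {b a} → a < b → range b a ≡ []
range-> a<b rewrite >⇒≤ᵇ≡false a<b = refl

∑-range-≤ : ∀ {b a} (f : ℕ → ℕ) → b ≤ a → ∑ f (range b a) ≡ sum (applyUpTo (f ∘ (b +_)) (suc (a ∸ b)))
∑-range-≤ {b} {a} f b≤a rewrite range-≤ b≤a = cong sum (map-applyUpTo (b +_) f (suc (a ∸ b)))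

∑-range-last : ∀ {b a} (f : ℕ → ℕ) → b ≤ suc a → ∑ f (range b (suc a)) ≡ ∑ f (range b a) + f (suc a)
∑-range-last {b} {a} f b≤1+a with m≤n⇒m<n∨m≡n b≤1+a
... | inj₁ (s≤s b≤a) = begin
  ∑ f (range b (suc a)) ≡⟨ ∑-range-≤ f b≤1+a ⟩
  sum (applyUpTo h (suc (suc a ∸ b))) ≡⟨ ∑-applyUpTo-snoc h (suc a ∸ b) ⟩
  sum (applyUpTo h (suc a ∸ b)) + f (b + (suc a ∸ b))
    ≡⟨ cong₂ _+_ (cong (sum ∘ applyUpTo h) (+-∸-assoc 1 b≤a)) (cong f (m+[n∸m]≡n b≤1+a)) ⟩
  sum (applyUpTo h (suc (a ∸ b))) + f (suc a) ≡⟨ cong (_+ f (suc a)) (∑-range-≤ f b≤a) ⟨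
  ∑ f (range b a) + f (suc a) ∎
  where h = f ∘ (b +_)
... | inj₂ refl rewrite range-> (n<1+n a) = begin
  ∑ f (range (suc a) (suc a)) ≡⟨ ∑-range-≤ f b≤1+a ⟩
  sum (applyUpTo h (suc (a ∸ a))) ≡⟨ cong (sum ∘ applyUpTo h ∘ suc) (n∸n≡0 a) ⟩
  f (suc a + 0) + 0 ≡⟨ trans (+-identityʳ _) (cong f (+-identityʳ (suc a))) ⟩
  f (suc a) ∎
  where h = f ∘ (suc a +_)

∑-range-suc : ∀ b a (f : ℕ → ℕ) → ∑ f (range (suc b) (suc a)) ≡ ∑ (f ∘ suc) (range b a)
∑-range-suc b a f with ≤-<-connex b a
... | inj₁ b≤a = trans (∑-range-≤ f (s≤s b≤a)) (sym (∑-range-≤ (f ∘ suc) b≤a))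
... | inj₂ a<b rewrite range-> a<b | range-> (s≤s a<b) = refl

∑-range-first : ∀ {b a} (f : ℕ → ℕ) → b ≤ a → ∑ f (range b a) ≡ f b + ∑ f (range (suc b) a)
∑-range-first {zero} {zero} f z≤n = refl
∑-range-first {zero} {suc a} f z≤n = begin
  ∑ f (range 0 (suc a)) ≡⟨ ∑-range-≤ {0} {suc a} f z≤n ⟩
  f 0 + sum (applyUpTo (f ∘ suc) (suc a)) ≡⟨ cong (f 0 +_) (∑-range-≤ {1} {suc a} f (s≤s z≤n)) ⟨
  f 0 + ∑ f (range 1 (suc a)) ∎
∑-range-first {suc b} {suc a} f (s≤s b≤a) = begin
  ∑ f (range (suc b) (suc a)) ≡⟨ ∑-range-suc b a f ⟩
  ∑ (f ∘ suc) (range b a) ≡⟨ ∑-range-first (f ∘ suc) b≤a ⟩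
  f (suc b) + ∑ (f ∘ suc) (range (suc b) a) ≡⟨ cong (f (suc b) +_) (∑-range-suc (suc b) a f) ⟨
  f (suc b) + ∑ f (range (suc (suc b)) (suc a)) ∎

∑-range-extend : ∀ c b (f : ℕ → ℕ) → f (suc b) ≡ 0 → ∑ f (range c b) ≡ ∑ f (range c (suc b))
∑-range-extend c b f f≡0 with ≤-<-connex c (suc b)
... | inj₁ c≤ = sym (trans (∑-range-last f c≤) (trans (cong (∑ f (range c b) +_) f≡0) (+-identityʳ _)))
... | inj₂ c> rewrite range-> c> | range-> (<-trans (n<1+n b) c>) = refl

∈-range : ∀ {k} b a → k ∈ range b a → (b ≤ k) × (k ≤ a)
∈-range {k} b a k∈ with ≤-<-connex b a
... | inj₂ a<b with () ← subst (k ∈_) (range-> a<b) k∈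
... | inj₁ b≤a with ∈-applyUpTo⁻ (b +_) (subst (k ∈_) (range-≤ b≤a) k∈)
... | i , s≤s i≤ , refl = m≤m+n b i , subst (b + i ≤_) (m+[n∸m]≡n b≤a) (+-monoʳ-≤ b i≤)

-- Shapes

dec : List ℕ → Bool
dec [] = true
dec (a ∷ []) = true
dec (a ∷ l@(b ∷ _)) = (b ≤ᵇ a) ∧ dec l

-- The index `r - 1` with an empty list at `r = 0`: the convention that e with index -1 is 0, which
-- spares case splits in the recursions.
prev : (ℕ → List X) → ℕ → List X
prev f zero = []
prev f (suc r) = f r

-- vstrips ν r lists all ν + ε with ε a 0/1-vector of weight r; only the
-- decreasing ones are genuine vertical strips, the others carry K′ = 0.
vstrips : List ℕ → ℕ → List (List ℕ)
vstrips [] zero = [ [] ]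
vstrips [] (suc r) = []
vstrips (a ∷ ν) r = map (a ∷_) (vstrips ν r) ++ map (suc a ∷_) (prev (vstrips ν) r)

-- K′ agrees with Kostka numbers on partitions padded with zeros
-- and vanishes on sequences that are not weakly decreasing.
K′ : List ℕ → List ℕ → ℕ
K′ ν [] = if sum ν ≡ᵇ 0 then 1 else 0
K′ ν (a ∷ β) = ∑ (λ κ → gate (sum ν ≡ᵇ sum κ + a) (K′ κ β)) (interl ν)

∑-interl-∷ : ∀ (g : List ℕ → ℕ) a b l →
  ∑ g (interl (a ∷ b ∷ l)) ≡ ∑ (λ k → ∑ (g ∘ (k ∷_)) (interl (b ∷ l))) (range b a)
∑-interl-∷ g a b l = trans (∑-concatMap g (λ k → map (k ∷_) (interl (b ∷ l))) (range b a))
  (∑-cong (range b a) (λ k → ∑-map g (k ∷_) (interl (b ∷ l))))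

∑-interl-nondec : ∀ (g : List ℕ → ℕ) ν → dec ν ≡ false → ∑ g (interl ν) ≡ 0
∑-interl-nondec g (a ∷ l@(b ∷ l′)) e =
  [ (λ b≤a → trans (∑-interl-∷ g a b l′) (∑-zero (range b a) (λ k _ → ∑-interl-nondec (g ∘ (k ∷_)) l
      (trans (cong (_∧ dec l) (sym (≤⇒≤ᵇ≡true b≤a))) e))))
  , large ]′ (≤-<-connex b a)
  where
  large : a < b → ∑ g (interl (a ∷ l)) ≡ 0
  large a<b rewrite range-> a<b = refl

sum≡0⇒dec : ∀ ν → sum ν ≡ 0 → dec ν ≡ true
sum≡0⇒dec [] _ = refl
sum≡0⇒dec (a ∷ []) _ = refl
sum≡0⇒dec (zero ∷ zero ∷ ν) e = sum≡0⇒dec (zero ∷ ν) e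

K′-nondec : ∀ ν β → dec ν ≡ false → K′ ν β ≡ 0
K′-nondec ν (a ∷ β) e = ∑-interl-nondec _ ν e
K′-nondec ν [] e with sum ν in s
... | suc _ = refl
... | zero with () ← trans (sym e) (sum≡0⇒dec ν s)

dec-∷ : ∀ {a b l} → b ≤ a → dec (b ∷ l) ≡ true → dec (a ∷ b ∷ l) ≡ true
dec-∷ b≤a d rewrite ≤⇒≤ᵇ≡true b≤a = d

dec-tail : ∀ a l → dec (a ∷ l) ≡ true → dec l ≡ true
dec-tail a [] d = refl
dec-tail a (b ∷ l) d = proj₂ (∧-true d)

dec-head : ∀ a b l → dec (a ∷ b ∷ l) ≡ true → b ≤ a
dec-head a b l d = ≤ᵇ≡true⇒≤ (proj₁ (∧-true {b ≤ᵇ a} d))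

record InterlCons (a : ℕ) (l κ : List ℕ) : Set where
  constructor interlCons
  field
    k : ℕ
    κ′ : List ℕ
    κ≡ : κ ≡ k ∷ κ′
    k≤ : k ≤ a
    κ-dec : dec (k ∷ κ′) ≡ true
    κ-sum : sum (k ∷ κ′) ≤ sum (a ∷ l)

∈-interl-∷ : ∀ {κ} a b l → κ ∈ interl (a ∷ b ∷ l) →
  ∃ λ k → ∃ λ κ′ → (κ ≡ k ∷ κ′) × (b ≤ k) × (k ≤ a) × (κ′ ∈ interl (b ∷ l))
∈-interl-∷ a b l κ∈ with ∈-concatMap⁻ (λ k → map (k ∷_) (interl (b ∷ l))) {xs = range b a} κ∈
... | any with find any
... | k , k∈ , κ∈′ with ∈-map⁻ (k ∷_) κ∈′
... | κ′ , κ′∈ , e = k , κ′ , e , proj₁ (∈-range b a k∈) , proj₂ (∈-range b a k∈) , κ′∈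

∈-interl : ∀ {κ} a l → κ ∈ interl (a ∷ l) → InterlCons a l κ
∈-interl a [] κ∈ with ∈-map⁻ (λ k → k ∷ []) κ∈
... | k , k∈ , e = interlCons k [] e (proj₂ (∈-range 0 a k∈)) refl (+-monoˡ-≤ 0 (proj₂ (∈-range 0 a k∈)))
∈-interl a (b ∷ l) κ∈ with ∈-interl-∷ a b l κ∈
... | k , κ′ , e , b≤k , k≤a , κ′∈ with ∈-interl b l κ′∈
... | interlCons k′ κ″ refl k′≤b d s =
  interlCons k (k′ ∷ κ″) e k≤a (dec-∷ {l = κ″} (≤-trans k′≤b b≤k) d) (+-mono-≤ k≤a s)

interl-dec : ∀ {κ} ν → κ ∈ interl ν → dec κ ≡ true
interl-dec [] (here refl) = refl
interl-dec (a ∷ l) κ∈ with ∈-interl a l κ∈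
... | interlCons _ _ refl _ d _ = d

interl-sum : ∀ {κ} ν → κ ∈ interl ν → sum κ ≤ sum ν
interl-sum [] (here refl) = z≤n
interl-sum (a ∷ l) κ∈ with ∈-interl a l κ∈
... | interlCons _ _ refl _ _ s = s

-- Used with `z` a block of zeros: decreasing sequences whose last rows are empty, hence free to
-- receive the boxes of a strip.
data Padded (z : List ℕ) : List ℕ → Set where
  base : Padded z z
  cons : ∀ {a b l} → b ≤ a → Padded z (b ∷ l) → Padded z (a ∷ b ∷ l)

00s 000s : List ℕ
00s = 0 ∷ 0 ∷ []
000s = 0 ∷ 00s

-- The rows of `κ` lie between consecutive rows of `ν`, so trailing zeros stay zero and the Pieri
-- induction keeps its free rows.
interl-padded : ∀ {κ ν} → Padded 00s ν → κ ∈ interl ν → Padded 00s κ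
interl-padded base (here refl) = base
interl-padded (cons {a} {b} {l} b≤a p) κ∈ with ∈-interl-∷ a b l κ∈
... | k , κ′ , refl , b≤k , k≤a , κ′∈ with interl-padded p κ′∈ | ∈-interl b l κ′∈
... | p′ | interlCons k′ κ″ refl k′≤b _ _ = cons (≤-trans k′≤b b≤k) p′

-- The Pieri rule for e₁ and e₂

∑-vstrips-∷ : ∀ (g : List ℕ → ℕ) a ν r →
  ∑ g (vstrips (a ∷ ν) r) ≡ ∑ (g ∘ (a ∷_)) (vstrips ν r) + ∑ (g ∘ (suc a ∷_)) (prev (vstrips ν) r)
∑-vstrips-∷ g a ν r = trans (∑-++ g (map (a ∷_) (vstrips ν r)) _)
  (cong₂ _+_ (∑-map g (a ∷_) (vstrips ν r)) (∑-map g (suc a ∷_) (prev (vstrips ν) r)))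

∑-prev-vstrips-∷ : ∀ (g : List ℕ → ℕ) a ν r →
  ∑ g (prev (vstrips (a ∷ ν)) r) ≡
  ∑ (g ∘ (a ∷_)) (prev (vstrips ν) r) + ∑ (g ∘ (suc a ∷_)) (prev (prev (vstrips ν)) r)
∑-prev-vstrips-∷ g a ν zero = refl
∑-prev-vstrips-∷ g a ν (suc r) = ∑-vstrips-∷ g a ν r

Vanishes : (List ℕ → ℕ) → Set
Vanishes g = ∀ σ → dec σ ≡ false → g σ ≡ 0

∑-interl-raise : ∀ (h : List ℕ → ℕ) b ρ → (∀ σ → h (suc b ∷ σ) ≡ 0) →
  ∑ h (interl (b ∷ ρ)) ≡ ∑ h (interl (suc b ∷ ρ))
∑-interl-raise h b [] h≡0 = begin
  ∑ h (interl (b ∷ [])) ≡⟨ ∑-map h (λ k → k ∷ []) (range 0 b) ⟩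
  ∑ (λ k → h (k ∷ [])) (range 0 b) ≡⟨ ∑-range-extend 0 b (λ k → h (k ∷ [])) (h≡0 []) ⟩
  ∑ (λ k → h (k ∷ [])) (range 0 (suc b)) ≡⟨ ∑-map h (λ k → k ∷ []) (range 0 (suc b)) ⟨
  ∑ h (interl (suc b ∷ [])) ∎
∑-interl-raise h b (c ∷ ρ) h≡0 = begin
  ∑ h (interl (b ∷ c ∷ ρ)) ≡⟨ ∑-interl-∷ h b c ρ ⟩
  ∑ (λ k → ∑ (h ∘ (k ∷_)) (interl (c ∷ ρ))) (range c b)
    ≡⟨ ∑-range-extend c b (λ k → ∑ (h ∘ (k ∷_)) (interl (c ∷ ρ))) (∑-zero (interl (c ∷ ρ)) (λ σ _ → h≡0 σ)) ⟩
  ∑ (λ k → ∑ (h ∘ (k ∷_)) (interl (c ∷ ρ))) (range c (suc b)) ≡⟨ ∑-interl-∷ h (suc b) c ρ ⟨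
  ∑ h (interl (suc b ∷ c ∷ ρ)) ∎

-- One step of the branching rule for a whole list of shapes: `g` receives every sequence left after
-- the strip of one variable is removed.
Φ : (List ℕ → ℕ) → List (List ℕ) → ℕ
Φ g ρs = ∑ (λ ρ → ∑ g (interl ρ)) ρs

Φ-∷-∷ : ∀ g a b (ρs : List (List ℕ)) →
  ∑ (λ ρ → ∑ g (interl (a ∷ b ∷ ρ))) ρs ≡
  ∑ (λ s → ∑ (λ ρ → ∑ (g ∘ (s ∷_)) (interl (b ∷ ρ))) ρs) (range b a)
Φ-∷-∷ g a b ρs = trans (∑-cong ρs (λ ρ → ∑-interl-∷ g a b ρ))
  (∑-swap (λ ρ s → ∑ (g ∘ (s ∷_)) (interl (b ∷ ρ))) ρs (range b a))

-- The choices of 0 or 1 in the first two rows give four ranges for the first interlacing entry `s`: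
-- `[b, a]`, `[b+1, a]`, `[b, a+1]`, `[b+1, a+1]`. The second lacks one term of `[b, a]`, and the
-- third has one term too many for `[b+1, a+1]`. Both defects sit at `s = b`, and `low≡high`
-- identifies the spare term with the missing one.
Φ-vstrips-∷-∷ : ∀ (g : List ℕ → ℕ) → Vanishes g → ∀ {a b} ν r → b ≤ a →
  Φ g (vstrips (a ∷ b ∷ ν) r) ≡
  ∑ (λ s → Φ (g ∘ (s ∷_)) (vstrips (b ∷ ν) r) + Φ (g ∘ (suc s ∷_)) (prev (vstrips (b ∷ ν)) r)) (range b a)
Φ-vstrips-∷-∷ g g0 {a} {b} ν r b≤a = begin
  Φ g (vstrips (a ∷ b ∷ ν) r)
    ≡⟨ ∑-vstrips-∷ (λ ρ → ∑ g (interl ρ)) a (b ∷ ν) r ⟩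
  ∑ (λ ρ → ∑ g (interl (a ∷ ρ))) (vstrips (b ∷ ν) r)
    + ∑ (λ ρ → ∑ g (interl (suc a ∷ ρ))) (prev (vstrips (b ∷ ν)) r)
    ≡⟨ cong₂ _+_ (∑-vstrips-∷ (λ ρ → ∑ g (interl (a ∷ ρ))) b ν r)
                 (∑-prev-vstrips-∷ (λ ρ → ∑ g (interl (suc a ∷ ρ))) b ν r) ⟩
  (∑ (λ ρ → ∑ g (interl (a ∷ b ∷ ρ))) V₀ + ∑ (λ ρ → ∑ g (interl (a ∷ suc b ∷ ρ))) V₁)
    + (∑ (λ ρ → ∑ g (interl (suc a ∷ b ∷ ρ))) V₁ + ∑ (λ ρ → ∑ g (interl (suc a ∷ suc b ∷ ρ))) V₂)
    ≡⟨ cong₂ _+_ (cong₂ _+_ (Φ-∷-∷ g a b V₀) (Φ-∷-∷ g a (suc b) V₁))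
                 (cong₂ _+_ (Φ-∷-∷ g (suc a) b V₁) (Φ-∷-∷ g (suc a) (suc b) V₂)) ⟩
  (∑ (low V₀) (range b a) + ∑ (high V₁) (range (suc b) a))
    + (∑ (low V₁) (range b (suc a)) + ∑ (high V₂) (range (suc b) (suc a)))
    ≡⟨ cong (λ t → (∑ (low V₀) (range b a) + ∑ (high V₁) (range (suc b) a)) + (t + ∑ (high V₂) (range (suc b) (suc a))))
         (trans (∑-range-first (low V₁) (m≤n⇒m≤1+n b≤a)) (cong (_+ ∑ (low V₁) (range (suc b) (suc a))) low≡high)) ⟩
  (∑ (low V₀) (range b a) + ∑ (high V₁) (range (suc b) a))
    + ((high V₁ b + ∑ (low V₁) (range (suc b) (suc a))) + ∑ (high V₂) (range (suc b) (suc a)))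
    ≡⟨ rearrange (∑ (low V₀) (range b a)) _ _ _ _ ⟩
  (∑ (low V₀) (range b a) + (high V₁ b + ∑ (high V₁) (range (suc b) a)))
    + (∑ (low V₁) (range (suc b) (suc a)) + ∑ (high V₂) (range (suc b) (suc a)))
    ≡⟨ cong₂ _+_ (cong (∑ (low V₀) (range b a) +_) (sym (∑-range-first (high V₁) b≤a)))
         (cong₂ _+_ (∑-range-suc b a (low V₁)) (∑-range-suc b a (high V₂))) ⟩
  (∑ (low V₀) (range b a) + ∑ (high V₁) (range b a))
    + (∑ (low V₁ ∘ suc) (range b a) + ∑ (high V₂ ∘ suc) (range b a))
    ≡⟨ cong₂ _+_ (∑-+ (low V₀) (high V₁) (range b a)) (∑-+ (low V₁ ∘ suc) (high V₂ ∘ suc) (range b a)) ⟨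
  ∑ (λ s → low V₀ s + high V₁ s) (range b a) + ∑ (λ s → low V₁ (suc s) + high V₂ (suc s)) (range b a)
    ≡⟨ ∑-+ _ _ (range b a) ⟨
  ∑ (λ s → (low V₀ s + high V₁ s) + (low V₁ (suc s) + high V₂ (suc s))) (range b a)
    ≡⟨ ∑-cong (range b a) (λ s → cong₂ _+_
         (∑-vstrips-∷ (λ ρ → ∑ (g ∘ (s ∷_)) (interl ρ)) b ν r)
         (∑-prev-vstrips-∷ (λ ρ → ∑ (g ∘ (suc s ∷_)) (interl ρ)) b ν r)) ⟨
  _ ∎
  where
  V₀ = vstrips ν r
  V₁ = prev (vstrips ν) r
  V₂ = prev (prev (vstrips ν)) r
  low high : List (List ℕ) → ℕ → ℕ
  low ρs s = ∑ (λ ρ → ∑ (g ∘ (s ∷_)) (interl (b ∷ ρ))) ρs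
  high ρs s = ∑ (λ ρ → ∑ (g ∘ (s ∷_)) (interl (suc b ∷ ρ))) ρs
  -- Raising the second row from `b` to `b+1` only adds sequences starting with `b, b+1`, on which
  -- `g` vanishes.
  low≡high : low V₁ b ≡ high V₁ b
  low≡high = ∑-cong V₁ (λ ρ → ∑-interl-raise (g ∘ (b ∷_)) b ρ
    (λ σ → g0 (b ∷ suc b ∷ σ) (cong (_∧ dec (suc b ∷ σ)) (>⇒≤ᵇ≡false (n<1+n b)))))
  rearrange : ∀ x y z u w → (x + y) + ((z + u) + w) ≡ (x + (z + y)) + (u + w)
  rearrange = solve 5 (λ x y z u w → (x :+ y) :+ ((z :+ u) :+ w) := (x :+ (z :+ y)) :+ (u :+ w)) refl
    where open +-*-Solver

-- One more variable: e_r(x,t) = e_r(x) + t e_{r-1}(x).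
Φ-vstrips : ∀ {ν} → Padded 00s ν → ∀ (g : List ℕ → ℕ) → Vanishes g → ∀ r → r ≤ 2 →
  Φ g (vstrips ν r) ≡ ∑ (λ κ → ∑ g (vstrips κ r) + ∑ g (prev (vstrips κ) r)) (interl ν)
Φ-vstrips base g g0 0 _ = sym (+-identityʳ _)
Φ-vstrips base g g0 1 _ rewrite g0 (0 ∷ 1 ∷ []) refl =
  solve 2 (λ x y → ((x :+ (y :+ con 0)) :+ con 0) := (((y :+ con 0) :+ (x :+ con 0)) :+ con 0)) refl (g (0 ∷ 0 ∷ [])) (g (1 ∷ 0 ∷ []))
  where open +-*-Solver
Φ-vstrips base g g0 2 _ rewrite g0 (0 ∷ 1 ∷ []) refl =
  solve 2 (λ x y → ((x :+ (y :+ con 0)) :+ con 0) := (((y :+ con 0) :+ (x :+ con 0)) :+ con 0)) refl (g (1 ∷ 0 ∷ [])) (g (1 ∷ 1 ∷ []))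
  where open +-*-Solver
-- For size 3 the identity would fail on two empty rows: the left side is empty while the right side
-- still contains `(1, 1)`.
Φ-vstrips base g g0 (suc (suc (suc r))) (s≤s (s≤s ()))
Φ-vstrips (cons {a} {b} {ν} b≤a p) g g0 r r≤2 = begin
  Φ g (vstrips (a ∷ b ∷ ν) r)
    ≡⟨ Φ-vstrips-∷-∷ g g0 ν r b≤a ⟩
  ∑ (λ s → Φ (g ∘ (s ∷_)) (vstrips (b ∷ ν) r) + Φ (g ∘ (suc s ∷_)) (prev (vstrips (b ∷ ν)) r)) (range b a)
    ≡⟨ ∑-cong (range b a) (λ s → begin
         _ ≡⟨ cong₂ _+_ (Φ-vstrips p (g ∘ (s ∷_)) (vanish s) r r≤2) (prevStep (g ∘ (suc s ∷_)) (vanish (suc s)) r r≤2) ⟩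
         _ ≡⟨ ∑-+ _ _ (interl (b ∷ ν)) ⟨
         _ ≡⟨ ∑-cong (interl (b ∷ ν)) (λ κ → begin
           _ ≡⟨ interchange (∑ (g ∘ (s ∷_)) (vstrips κ r)) _ _ _ ⟩
           _ ≡⟨ cong₂ _+_ (∑-vstrips-∷ g s κ r) (∑-prev-vstrips-∷ g s κ r) ⟨
           ∑ g (vstrips (s ∷ κ) r) + ∑ g (prev (vstrips (s ∷ κ)) r) ∎) ⟩
         ∑ (λ κ → ∑ g (vstrips (s ∷ κ) r) + ∑ g (prev (vstrips (s ∷ κ)) r)) (interl (b ∷ ν)) ∎) ⟩
  _ ≡⟨ ∑-interl-∷ (λ κ → ∑ g (vstrips κ r) + ∑ g (prev (vstrips κ) r)) a b ν ⟨
  _ ∎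
  where
  vanish : ∀ s → Vanishes (g ∘ (s ∷_))
  vanish s (c ∷ σ) d = g0 (s ∷ c ∷ σ) (∧-false (c ≤ᵇ s) d)
  prevStep : ∀ h → Vanishes h → ∀ r → r ≤ 2 → Φ h (prev (vstrips (b ∷ ν)) r) ≡
    ∑ (λ κ → ∑ h (prev (vstrips κ) r) + ∑ h (prev (prev (vstrips κ)) r)) (interl (b ∷ ν))
  prevStep h h0 zero _ = sym (∑-0 (interl (b ∷ ν)))
  prevStep h h0 (suc r) r≤2 = Φ-vstrips p h h0 r (<⇒≤ r≤2)

vstrips-0 : ∀ ν → vstrips ν 0 ≡ [ ν ]
vstrips-0 [] = refl
vstrips-0 (a ∷ ν) rewrite vstrips-0 ν = refl

∈-vstrips-∷ : ∀ {σ} a ν r → σ ∈ vstrips (a ∷ ν) r →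
  (∃ λ σ′ → (σ ≡ a ∷ σ′) × (σ′ ∈ vstrips ν r)) ⊎ (∃ λ σ′ → (σ ≡ suc a ∷ σ′) × (σ′ ∈ prev (vstrips ν) r))
∈-vstrips-∷ a ν r σ∈ with ∈-++⁻ (map (a ∷_) (vstrips ν r)) σ∈
... | inj₁ σ∈ˡ with ∈-map⁻ (a ∷_) σ∈ˡ
...   | σ′ , σ′∈ , e = inj₁ (σ′ , e , σ′∈)
∈-vstrips-∷ a ν r σ∈ | inj₂ σ∈ʳ with ∈-map⁻ (suc a ∷_) σ∈ʳ
...   | σ′ , σ′∈ , e = inj₂ (σ′ , e , σ′∈)

vstrips-sum : ∀ {σ} ν r → σ ∈ vstrips ν r → sum σ ≡ sum ν + r
vstrips-sum [] zero (here refl) = refl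
vstrips-sum (a ∷ ν) r σ∈ with ∈-vstrips-∷ a ν r σ∈
vstrips-sum (a ∷ ν) r σ∈ | inj₁ (σ′ , refl , σ′∈) =
  trans (cong (a +_) (vstrips-sum ν r σ′∈)) (sym (+-assoc a (sum ν) r))
vstrips-sum (a ∷ ν) (suc r) σ∈ | inj₂ (σ′ , refl , σ′∈) =
  trans (cong (λ t → suc (a + t)) (vstrips-sum ν r σ′∈))
    (trans (cong suc (sym (+-assoc a (sum ν) r))) (sym (+-suc (a + sum ν) r)))

-- dn β r lists all β − ε with ε a 0/1-vector of weight r: the exponents met by e_r.
dn : List ℕ → ℕ → List (List ℕ)
dn [] zero = [ [] ]
dn [] (suc r) = []
dn (zero ∷ β) r = map (0 ∷_) (dn β r)
dn (suc a ∷ β) r = map (suc a ∷_) (dn β r) ++ map (a ∷_) (prev (dn β) r)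

dn-0 : ∀ β → dn β 0 ≡ [ β ]
dn-0 [] = refl
dn-0 (zero ∷ β) rewrite dn-0 β = refl
dn-0 (suc a ∷ β) rewrite dn-0 β = refl

∑-dn-suc : ∀ (g : List ℕ → ℕ) a β r →
  ∑ g (dn (suc a ∷ β) r) ≡ ∑ (g ∘ (suc a ∷_)) (dn β r) + ∑ (g ∘ (a ∷_)) (prev (dn β) r)
∑-dn-suc g a β r = trans (∑-++ g (map (suc a ∷_) (dn β r)) _)
  (cong₂ _+_ (∑-map g (suc a ∷_) (dn β r)) (∑-map g (a ∷_) (prev (dn β) r)))

-- Induction on the variables. A 0/1-vector of weight `r` spends one unit or none on the first
-- variable; once that variable is peeled from `ν`, the induction hypothesis treats the rest, and
-- `Φ-vstrips` reassembles the two cases.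
pieri : ∀ β {ν} → Padded 00s ν → ∀ r → r ≤ 2 →
  ∑ (K′ ν) (dn β r) ≡ ∑ (λ σ → K′ σ β) (vstrips ν r)
pieri [] {ν} p zero _ rewrite vstrips-0 ν = refl
pieri [] {ν} p (suc r) _ = sym (∑-zero (vstrips ν (suc r))
  (λ σ σ∈ → cong (λ b → if b then 1 else 0) (≢⇒≡ᵇ≡false (λ e → m+1+n≢0 (sum ν) (trans (sym (vstrips-sum ν (suc r) σ∈)) e)))))
pieri (a ∷ β) {ν} p r r≤2 = begin
  ∑ (K′ ν) (dn (a ∷ β) r) ≡⟨ expand a ⟩
  ∑ (λ κ → ∑ (weight a) (vstrips κ r)) (interl ν) + ∑ (λ κ → ∑ (weight a) (prev (vstrips κ) r)) (interl ν)
    ≡⟨ ∑-+ _ _ (interl ν) ⟨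
  ∑ (λ κ → ∑ (weight a) (vstrips κ r) + ∑ (weight a) (prev (vstrips κ) r)) (interl ν)
    ≡⟨ Φ-vstrips p (weight a) (λ σ d → trans (cong (gate _) (K′-nondec σ β d)) (gate-0 (sum ν + r ≡ᵇ sum σ + a))) r r≤2 ⟨
  Φ (weight a) (vstrips ν r)
    ≡⟨ ∑-cong-∈ (vstrips ν r) (λ ρ ρ∈ → ∑-cong (interl ρ) (λ σ →
         cong (λ t → gate (t ≡ᵇ sum σ + a) (K′ σ β)) (vstrips-sum ν r ρ∈))) ⟨
  ∑ (λ σ → K′ σ (a ∷ β)) (vstrips ν r) ∎
  where
  weight : ℕ → List ℕ → ℕ
  weight c σ = gate (sum ν + r ≡ᵇ sum σ + c) (K′ σ β)

  gate-0 : ∀ b → gate b 0 ≡ 0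
  gate-0 true = refl
  gate-0 false = refl

  -- `d` and `c` are the first exponent before and after lowering, and `t` is the weight left for
  -- the other variables.
  peel : ∀ c t d → t ≤ 2 → c + r ≡ t + d →
    ∑ (λ γ → K′ ν (c ∷ γ)) (dn β t) ≡ ∑ (λ κ → ∑ (weight d) (vstrips κ t)) (interl ν)
  peel c t d t≤2 e = begin
    ∑ (λ γ → K′ ν (c ∷ γ)) (dn β t) ≡⟨ ∑-swap _ (dn β t) (interl ν) ⟩
    ∑ (λ κ → ∑ (λ γ → gate (sum ν ≡ᵇ sum κ + c) (K′ κ γ)) (dn β t)) (interl ν)
      ≡⟨ ∑-cong-∈ (interl ν) (λ κ κ∈ → begin
           _ ≡⟨ ∑-gate (sum ν ≡ᵇ sum κ + c) (K′ κ) (dn β t) ⟩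
           _ ≡⟨ cong (gate (sum ν ≡ᵇ sum κ + c)) (pieri β (interl-padded p κ∈) t t≤2) ⟩
           _ ≡⟨ ∑-gate (sum ν ≡ᵇ sum κ + c) (λ σ → K′ σ β) (vstrips κ t) ⟨
           _ ≡⟨ ∑-cong-∈ (vstrips κ t) (λ σ σ∈ → cong (λ b → gate b (K′ σ β)) (shift κ σ (vstrips-sum κ t σ∈))) ⟩
           ∑ (weight d) (vstrips κ t) ∎) ⟩
    _ ∎
    where
    shift : ∀ κ σ → sum σ ≡ sum κ + t → (sum ν ≡ᵇ sum κ + c) ≡ (sum ν + r ≡ᵇ sum σ + d)
    shift κ σ s = ≡ᵇ-cong-⇔ (λ x → trans (cong (_+ r) x) eq) (λ x → +-cancelʳ-≡ r (sum ν) (sum κ + c) (trans x (sym eq)))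
      where
      eq : sum κ + c + r ≡ sum σ + d
      eq = begin
        sum κ + c + r ≡⟨ +-assoc (sum κ) c r ⟩
        sum κ + (c + r) ≡⟨ cong (sum κ +_) e ⟩
        sum κ + (t + d) ≡⟨ +-assoc (sum κ) t d ⟨
        sum κ + t + d ≡⟨ cong (_+ d) s ⟨
        sum σ + d ∎

  peelPrev : ∀ c s → r ≡ s → ∑ (λ γ → K′ ν (c ∷ γ)) (prev (dn β) s) ≡
    ∑ (λ κ → ∑ (weight (suc c)) (prev (vstrips κ) s)) (interl ν)
  peelPrev c zero _ = sym (∑-0 (interl ν))
  peelPrev c (suc s) refl = peel c s (suc c) (<⇒≤ r≤2)
    (trans (+-suc c s) (trans (cong suc (+-comm c s)) (sym (+-suc s c))))

  -- An exponent 0 cannot be lowered, yet `Φ-vstrips` still offers strips one box short; their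
  -- degree is too small to pass the test.
  weight-0 : ∀ s → r ≡ s → ∑ (λ κ → ∑ (weight 0) (prev (vstrips κ) s)) (interl ν) ≡ 0
  weight-0 zero _ = ∑-0 (interl ν)
  weight-0 (suc s) refl = ∑-zero (interl ν) (λ κ κ∈ → ∑-zero (vstrips κ s) (λ σ σ∈ →
    cong (λ b → gate b (K′ σ β)) (≢⇒≡ᵇ≡false (λ e → <⇒≢ (strict κ κ∈ σ (vstrips-sum κ s σ∈)) (sym e)))))
    where
    strict : ∀ κ → κ ∈ interl ν → ∀ σ → sum σ ≡ sum κ + s → sum σ + 0 < sum ν + suc s
    strict κ κ∈ σ e = subst₂ _<_ (sym (trans (+-identityʳ (sum σ)) e)) (sym (+-suc (sum ν) s))
      (s≤s (+-monoˡ-≤ s (interl-sum ν κ∈)))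

  expand : ∀ c → ∑ (K′ ν) (dn (c ∷ β) r) ≡
    ∑ (λ κ → ∑ (weight c) (vstrips κ r)) (interl ν) + ∑ (λ κ → ∑ (weight c) (prev (vstrips κ) r)) (interl ν)
  expand zero = begin
    ∑ (K′ ν) (map (0 ∷_) (dn β r)) ≡⟨ ∑-map (K′ ν) (0 ∷_) (dn β r) ⟩
    ∑ (λ γ → K′ ν (0 ∷ γ)) (dn β r) ≡⟨ peel 0 r 0 r≤2 (sym (+-identityʳ r)) ⟩
    _ ≡⟨ +-identityʳ _ ⟨
    _ ≡⟨ cong (∑ (λ κ → ∑ (weight 0) (vstrips κ r)) (interl ν) +_) (weight-0 r refl) ⟨
    _ ∎
  expand (suc c) = trans (∑-dn-suc (K′ ν) c β r) (cong₂ _+_ (peel (suc c) r (suc c) r≤2 (+-comm (suc c) r)) (peelPrev c r refl))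

-- The Pieri rule for h₂

-- hstrips ν lists ν + e_i + e_j over rows j ≤ i for which ν + e_i is a partition.
hstrips : List ℕ → List (List ℕ)
hstrips [] = []
hstrips (a ∷ ν) = map (a ∷_) (hstrips ν) ++
  (map (suc a ∷_) (filterᵇ (λ ρ → dec (a ∷ ρ)) (vstrips ν 1)) ++ [ suc (suc a) ∷ ν ])

∑-hstrips-∷ : ∀ (g : List ℕ → ℕ) a ν → ∑ g (hstrips (a ∷ ν)) ≡
  ∑ (g ∘ (a ∷_)) (hstrips ν) + (∑ (λ ρ → gate (dec (a ∷ ρ)) (g (suc a ∷ ρ))) (vstrips ν 1) + g (suc (suc a) ∷ ν))
∑-hstrips-∷ g a ν = trans (∑-++ g (map (a ∷_) (hstrips ν)) _) (cong₂ _+_ (∑-map g (a ∷_) (hstrips ν))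
  (trans (∑-++ g (map (suc a ∷_) (filterᵇ (λ ρ → dec (a ∷ ρ)) (vstrips ν 1))) _) (cong₂ _+_
    (trans (∑-map g (suc a ∷_) (filterᵇ (λ ρ → dec (a ∷ ρ)) (vstrips ν 1)))
      (∑-filterᵇ (g ∘ (suc a ∷_)) (λ ρ → dec (a ∷ ρ)) (vstrips ν 1)))
    (+-identityʳ _))))

gate-+ : ∀ b m n → gate b (m + n) ≡ gate b m + gate b n
gate-+ true m n = refl
gate-+ false m n = refl

-- Rows below i only grow, so a violation at row i survives adding a box below.
gate-dec-∷ : ∀ (g : List ℕ → ℕ) → Vanishes g → ∀ a ρ →
  gate (dec (a ∷ ρ)) (∑ (g ∘ (a ∷_)) (vstrips ρ 1)) ≡ gate (dec ρ) (∑ (g ∘ (a ∷_)) (vstrips ρ 1))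
gate-dec-∷ g g0 a [] = refl
gate-dec-∷ g g0 a (c ∷ ρ) with ≤-<-connex c a
... | inj₁ c≤a rewrite ≤⇒≤ᵇ≡true c≤a = refl
... | inj₂ a<c = trans (cong (gate (dec (a ∷ c ∷ ρ))) zeros) (trans (both (dec (a ∷ c ∷ ρ)) (dec (c ∷ ρ))) (cong (gate (dec (c ∷ ρ))) (sym zeros)))
  where
  both : ∀ x y → gate x 0 ≡ gate y 0
  both true true = refl
  both true false = refl
  both false true = refl
  both false false = refl
  kill : ∀ d σ → a < d → g (a ∷ d ∷ σ) ≡ 0
  kill d σ a<d = g0 (a ∷ d ∷ σ) (cong (_∧ dec (d ∷ σ)) (>⇒≤ᵇ≡false a<d))
  zeros : ∑ (g ∘ (a ∷_)) (vstrips (c ∷ ρ) 1) ≡ 0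
  zeros = ∑-zero (vstrips (c ∷ ρ) 1) (λ σ σ∈ → vanish σ (∈-vstrips-∷ c ρ 1 σ∈))
    where
    vanish : ∀ σ → (∃ λ σ′ → (σ ≡ c ∷ σ′) × (σ′ ∈ vstrips ρ 1)) ⊎ (∃ λ σ′ → (σ ≡ suc c ∷ σ′) × (σ′ ∈ vstrips ρ 0)) →
      g (a ∷ σ) ≡ 0
    vanish _ (inj₁ (σ′ , refl , _)) = kill c σ′ a<c
    vanish _ (inj₂ (σ′ , refl , _)) = kill (suc c) σ′ (m≤n⇒m≤1+n a<c)

dec-suc : ∀ a ν → dec (a ∷ ν) ≡ true → dec (suc a ∷ ν) ≡ true
dec-suc a [] d = refl
dec-suc a (b ∷ ν) d = dec-∷ {l = ν} (m≤n⇒m≤1+n (dec-head a b ν d)) (dec-tail a (b ∷ ν) d)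

-- Adding two boxes one after the other: the second one either lies
-- strictly below the first (a vertical strip) or not.
∑-two-boxes : ∀ (g : List ℕ → ℕ) → Vanishes g → ∀ ν → dec ν ≡ true →
  ∑ (λ ρ → gate (dec ρ) (∑ g (vstrips ρ 1))) (vstrips ν 1) ≡ ∑ g (vstrips ν 2) + ∑ g (hstrips ν)
∑-two-boxes g g0 [] d = refl
∑-two-boxes g g0 (a ∷ ν) d = begin
  ∑ (λ ρ → gate (dec ρ) (∑ g (vstrips ρ 1))) (vstrips (a ∷ ν) 1)
    ≡⟨ ∑-vstrips-∷ (λ ρ → gate (dec ρ) (∑ g (vstrips ρ 1))) a ν 1 ⟩
  ∑ (λ ρ → gate (dec (a ∷ ρ)) (∑ g (vstrips (a ∷ ρ) 1))) (vstrips ν 1)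
    + ∑ (λ ρ → gate (dec (suc a ∷ ρ)) (∑ g (vstrips (suc a ∷ ρ) 1))) (vstrips ν 0)
    ≡⟨ cong₂ _+_ (∑-cong (vstrips ν 1) inner) outer ⟩
  ∑ (λ ρ → gate (dec ρ) (∑ (g ∘ (a ∷_)) (vstrips ρ 1)) + gate (dec (a ∷ ρ)) (g (suc a ∷ ρ))) (vstrips ν 1)
    + (∑ (g ∘ (suc a ∷_)) (vstrips ν 1) + g (suc (suc a) ∷ ν))
    ≡⟨ cong (_+ (∑ (g ∘ (suc a ∷_)) (vstrips ν 1) + g (suc (suc a) ∷ ν))) (trans (∑-+ _ _ (vstrips ν 1))
         (cong (_+ mid) (∑-two-boxes (g ∘ (a ∷_)) vanish ν (dec-tail a ν d)))) ⟩
  (∑ (g ∘ (a ∷_)) (vstrips ν 2) + ∑ (g ∘ (a ∷_)) (hstrips ν) + mid)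
    + (∑ (g ∘ (suc a ∷_)) (vstrips ν 1) + g (suc (suc a) ∷ ν))
    ≡⟨ rearrange (∑ (g ∘ (a ∷_)) (vstrips ν 2)) _ _ _ _ ⟩
  (∑ (g ∘ (a ∷_)) (vstrips ν 2) + ∑ (g ∘ (suc a ∷_)) (vstrips ν 1))
    + (∑ (g ∘ (a ∷_)) (hstrips ν) + (mid + g (suc (suc a) ∷ ν)))
    ≡⟨ cong₂ _+_ (∑-vstrips-∷ g a ν 2) (∑-hstrips-∷ g a ν) ⟨
  ∑ g (vstrips (a ∷ ν) 2) + ∑ g (hstrips (a ∷ ν)) ∎
  where
  mid = ∑ (λ ρ → gate (dec (a ∷ ρ)) (g (suc a ∷ ρ))) (vstrips ν 1)
  vanish : Vanishes (g ∘ (a ∷_))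
  vanish (c ∷ σ) e = g0 (a ∷ c ∷ σ) (∧-false (c ≤ᵇ a) e)
  step : ∀ b ρ → ∑ g (vstrips (b ∷ ρ) 1) ≡ ∑ (g ∘ (b ∷_)) (vstrips ρ 1) + g (suc b ∷ ρ)
  step b ρ = trans (∑-vstrips-∷ g b ρ 1) (cong (∑ (g ∘ (b ∷_)) (vstrips ρ 1) +_)
    (trans (cong (∑ (g ∘ (suc b ∷_))) (vstrips-0 ρ)) (+-identityʳ _)))
  inner : ∀ ρ → gate (dec (a ∷ ρ)) (∑ g (vstrips (a ∷ ρ) 1)) ≡
    gate (dec ρ) (∑ (g ∘ (a ∷_)) (vstrips ρ 1)) + gate (dec (a ∷ ρ)) (g (suc a ∷ ρ))
  inner ρ = trans (cong (gate (dec (a ∷ ρ))) (step a ρ)) (trans (gate-+ (dec (a ∷ ρ)) _ _)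
    (cong (_+ gate (dec (a ∷ ρ)) (g (suc a ∷ ρ))) (gate-dec-∷ g g0 a ρ)))
  outer : ∑ (λ ρ → gate (dec (suc a ∷ ρ)) (∑ g (vstrips (suc a ∷ ρ) 1))) (vstrips ν 0) ≡
    ∑ (g ∘ (suc a ∷_)) (vstrips ν 1) + g (suc (suc a) ∷ ν)
  outer = begin
    _ ≡⟨ cong (∑ (λ ρ → gate (dec (suc a ∷ ρ)) (∑ g (vstrips (suc a ∷ ρ) 1)))) (vstrips-0 ν) ⟩
    _ ≡⟨ +-identityʳ _ ⟩
    gate (dec (suc a ∷ ν)) (∑ g (vstrips (suc a ∷ ν) 1))
      ≡⟨ cong (λ b → gate b (∑ g (vstrips (suc a ∷ ν) 1))) (dec-suc a ν d) ⟩
    ∑ g (vstrips (suc a ∷ ν) 1) ≡⟨ step (suc a) ν ⟩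
    _ ∎
  rearrange : ∀ x y z u w → (x + y + z) + (u + w) ≡ (x + u) + (y + (z + w))
  rearrange = solve 5 (λ x y z u w → (x :+ y :+ z) :+ (u :+ w) := (x :+ u) :+ (y :+ (z :+ w))) refl
    where open +-*-Solver

padded-weaken : ∀ {ν} → Padded 000s ν → Padded 00s ν
padded-weaken base = cons z≤n base
padded-weaken (cons b≤a p) = cons b≤a (padded-weaken p)

padded-dec : ∀ {ν} → Padded 00s ν → dec ν ≡ true
padded-dec base = refl
padded-dec (cons {l = l} b≤a p) = dec-∷ {l = l} b≤a (padded-dec p)

-- A box that keeps the shape decreasing occupies at most the first of the three empty rows, so two
-- remain for the next box.
padded-box : ∀ {ν ρ} → Padded 000s ν → ρ ∈ vstrips ν 1 → dec ρ ≡ true → Padded 00s ρ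
padded-box base (here refl) ()
padded-box base (there (here refl)) ()
padded-box base (there (there (here refl))) d = cons z≤n base
padded-box (cons {a} {b} {l} b≤a p) ρ∈ d with ∈-vstrips-∷ a (b ∷ l) 1 ρ∈
... | inj₁ ([] , refl , ρ∈′) with () ← padded-box p ρ∈′ refl
... | inj₁ (c ∷ ρ′ , refl , ρ∈′) = cons (dec-head a c ρ′ d) (padded-box p ρ∈′ (dec-tail a (c ∷ ρ′) d))
... | inj₂ (ρ′ , refl , ρ∈′) with subst (ρ′ ∈_) (vstrips-0 (b ∷ l)) ρ∈′
...   | here refl = cons (m≤n⇒m≤1+n b≤a) (padded-weaken p)

-- Multiplication operators

Fn : Set
Fn = List ℕ → ℕ

-- A linear operator given by its transpose: the coefficient at `β` of the image is the sum of the
-- coefficients at the vectors in `T β`.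
op : (List ℕ → List (List ℕ)) → Fn → Fn
op T g β = ∑ g (T β)

-- M r, B and A are multiplication by p_r, e₂ and h₂ = p₂ + e₂.
M : ℕ → Fn → Fn
M r = op (decrs r)

B A : Fn → Fn
B = op (λ β → dn β 2)
A = op (λ β → decrs 2 β ++ dn β 2)

infixl 6 _⊕_
_⊕_ : Fn → Fn → Fn
(f ⊕ g) β = f β + g β

op-cong : ∀ T {f g : Fn} → f ≗ g → op T f ≗ op T g
op-cong T e β = ∑-cong (T β) e

op-⊕ : ∀ T (f g : Fn) → op T (f ⊕ g) ≗ op T f ⊕ op T g
op-⊕ T f g β = ∑-+ f g (T β)

A-split : ∀ g → A g ≗ M 2 g ⊕ B g
A-split g β = ∑-++ g (decrs 2 β) (dn β 2)

-- Multiplication by the `r`-th power of the first variable x, so that `M-∷` reads p_r(x, y) = x^r +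
-- p_r(y).
lower : ℕ → ℕ → (ℕ → ℕ) → ℕ
lower r a f = gate (r ≤ᵇ a) (f (a ∸ r))

M-∷ : ∀ r g a β → M r g (a ∷ β) ≡ lower r a (λ a′ → g (a′ ∷ β)) + M r (g ∘ (a ∷_)) β
M-∷ r g a β with r ≤ᵇ a
... | true = cong (g (a ∸ r ∷ β) +_) (∑-map g (a ∷_) (decrs r β))
... | false = ∑-map g (a ∷_) (decrs r β)

suc-≤ᵇ : ∀ r a → (suc r ≤ᵇ suc a) ≡ (r ≤ᵇ a)
suc-≤ᵇ zero a = refl
suc-≤ᵇ (suc r) a = refl

lower-+ : ∀ r s a f → lower r a (λ a′ → lower s a′ f) ≡ lower (r + s) a f
lower-+ zero s a f = refl
lower-+ (suc r) s zero f = refl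
lower-+ (suc r) s (suc a) f rewrite suc-≤ᵇ r a | suc-≤ᵇ (r + s) a = lower-+ r s a f

lower-swap : ∀ r s a f → lower r a (λ a′ → lower s a′ f) ≡ lower s a (λ a′ → lower r a′ f)
lower-swap r s a f = trans (lower-+ r s a f) (trans (cong (λ t → lower t a f) (+-comm r s)) (sym (lower-+ s r a f)))

lower-⊕ : ∀ r a f g → lower r a (λ a′ → f a′ + g a′) ≡ lower r a f + lower r a g
lower-⊕ r a f g = gate-+ (r ≤ᵇ a) (f (a ∸ r)) (g (a ∸ r))

M-lower : ∀ r s a (g : Fn) β → M r (λ γ → lower s a (λ a′ → g (a′ ∷ γ))) β ≡ lower s a (λ a′ → M r (g ∘ (a′ ∷_)) β)
M-lower r s a g β = ∑-gate (s ≤ᵇ a) (g ∘ (a ∸ s ∷_)) (decrs r β)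

M-M-∷ : ∀ r s (g : Fn) a β → M r (M s g) (a ∷ β) ≡
  (lower r a (λ a′ → lower s a′ (λ a″ → g (a″ ∷ β))) + lower r a (λ a′ → M s (g ∘ (a′ ∷_)) β))
  + (lower s a (λ a′ → M r (g ∘ (a′ ∷_)) β) + M r (M s (g ∘ (a ∷_))) β)
M-M-∷ r s g a β = begin
  M r (M s g) (a ∷ β) ≡⟨ M-∷ r (M s g) a β ⟩
  lower r a (λ a′ → M s g (a′ ∷ β)) + M r (M s g ∘ (a ∷_)) β
    ≡⟨ cong₂ _+_ (cong (gate (r ≤ᵇ a)) (M-∷ s g (a ∸ r) β)) (op-cong (decrs r) (M-∷ s g a) β) ⟩
  lower r a (λ a′ → lower s a′ (λ a″ → g (a″ ∷ β)) + M s (g ∘ (a′ ∷_)) β)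
    + M r ((λ γ → lower s a (λ a′ → g (a′ ∷ γ))) ⊕ M s (g ∘ (a ∷_))) β
    ≡⟨ cong₂ _+_ (lower-⊕ r a (λ a′ → lower s a′ (λ a″ → g (a″ ∷ β))) (λ a′ → M s (g ∘ (a′ ∷_)) β))
         (trans (op-⊕ (decrs r) (λ γ → lower s a (λ a′ → g (a′ ∷ γ))) (M s (g ∘ (a ∷_))) β)
           (cong (_+ M r (M s (g ∘ (a ∷_))) β) (M-lower r s a g β))) ⟩
  _ ∎

M-comm : ∀ r s g → M r (M s g) ≗ M s (M r g)
M-comm r s g [] = refl
M-comm r s g (a ∷ β) = begin
  M r (M s g) (a ∷ β) ≡⟨ M-M-∷ r s g a β ⟩
  _ ≡⟨ cong₂ (λ x y → (x + lower r a (λ a′ → M s (g ∘ (a′ ∷_)) β)) + (lower s a (λ a′ → M r (g ∘ (a′ ∷_)) β) + y))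
         (lower-swap r s a (λ a″ → g (a″ ∷ β))) (M-comm r s (g ∘ (a ∷_)) β) ⟩
  _ ≡⟨ interchange (lower s a (λ a′ → lower r a′ (λ a″ → g (a″ ∷ β)))) _ _ _ ⟩
  _ ≡⟨ M-M-∷ s r g a β ⟨
  M s (M r g) (a ∷ β) ∎

dn-1 : ∀ g → op (λ β → dn β 1) g ≗ M 1 g
dn-1 g [] = refl
dn-1 g (zero ∷ β) = trans (∑-map g (0 ∷_) (dn β 1)) (trans (dn-1 (g ∘ (0 ∷_)) β) (sym (M-∷ 1 g 0 β)))
dn-1 g (suc a ∷ β) = begin
  ∑ g (dn (suc a ∷ β) 1) ≡⟨ ∑-dn-suc g a β 1 ⟩
  ∑ (g ∘ (suc a ∷_)) (dn β 1) + ∑ (g ∘ (a ∷_)) (dn β 0)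
    ≡⟨ cong₂ _+_ (dn-1 (g ∘ (suc a ∷_)) β) (trans (cong (∑ (g ∘ (a ∷_))) (dn-0 β)) (+-identityʳ _)) ⟩
  M 1 (g ∘ (suc a ∷_)) β + g (a ∷ β) ≡⟨ +-comm (M 1 (g ∘ (suc a ∷_)) β) _ ⟩
  g (a ∷ β) + M 1 (g ∘ (suc a ∷_)) β ≡⟨ M-∷ 1 g (suc a) β ⟨
  M 1 g (suc a ∷ β) ∎

B-∷ : ∀ g a β → B g (a ∷ β) ≡ lower 1 a (λ a′ → M 1 (g ∘ (a′ ∷_)) β) + B (g ∘ (a ∷_)) β
B-∷ g zero β = ∑-map g (0 ∷_) (dn β 2)
B-∷ g (suc a) β = begin
  ∑ g (dn (suc a ∷ β) 2) ≡⟨ ∑-dn-suc g a β 2 ⟩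
  B (g ∘ (suc a ∷_)) β + ∑ (g ∘ (a ∷_)) (dn β 1) ≡⟨ cong (B (g ∘ (suc a ∷_)) β +_) (dn-1 (g ∘ (a ∷_)) β) ⟩
  B (g ∘ (suc a ∷_)) β + M 1 (g ∘ (a ∷_)) β ≡⟨ +-comm (B (g ∘ (suc a ∷_)) β) _ ⟩
  M 1 (g ∘ (a ∷_)) β + B (g ∘ (suc a ∷_)) β ∎

-- p₁² = p₂ + 2 e₂
M₁-square : ∀ g → M 1 (M 1 g) ≗ M 2 g ⊕ (B g ⊕ B g)
M₁-square g [] = refl
M₁-square g (a ∷ β) = begin
  M 1 (M 1 g) (a ∷ β) ≡⟨ M-M-∷ 1 1 g a β ⟩
  _ ≡⟨ cong₂ (λ x y → (x + z) + (z + y)) (lower-+ 1 1 a (λ a″ → g (a″ ∷ β))) (M₁-square (g ∘ (a ∷_)) β) ⟩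
  (l₂ + z) + (z + (M 2 (g ∘ (a ∷_)) β + (b + b))) ≡⟨ rearrange l₂ z (M 2 (g ∘ (a ∷_)) β) b ⟩
  (l₂ + M 2 (g ∘ (a ∷_)) β) + ((z + b) + (z + b)) ≡⟨ cong₂ _+_ (M-∷ 2 g a β) (cong₂ _+_ (B-∷ g a β) (B-∷ g a β)) ⟨
  M 2 g (a ∷ β) + (B g (a ∷ β) + B g (a ∷ β)) ∎
  where
  l₂ = lower 2 a (λ a″ → g (a″ ∷ β))
  z = lower 1 a (λ a′ → M 1 (g ∘ (a′ ∷_)) β)
  b = B (g ∘ (a ∷_)) β
  rearrange : ∀ x z m b → (x + z) + (z + (m + (b + b))) ≡ (x + m) + ((z + b) + (z + b))
  rearrange = solve 4 (λ x z m b → (x :+ z) :+ (z :+ (m :+ (b :+ b))) := (x :+ m) :+ ((z :+ b) :+ (z :+ b))) refl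
    where open +-*-Solver

M₁-square-AB : ∀ g → M 1 (M 1 g) ≗ A g ⊕ B g
M₁-square-AB g β = trans (M₁-square g β) (trans (sym (+-assoc (M 2 g β) (B g β) (B g β))) (cong (_+ B g β) (sym (A-split g β))))

double-injective : ∀ {m n} → m + m ≡ n + n → m ≡ n
double-injective {m} {n} e = *-cancelʳ-≡ m n 2 (trans (dbl m) (trans e (sym (dbl n))))
  where
  dbl : ∀ k → k * 2 ≡ k + k
  dbl k = trans (*-comm k 2) (cong (k +_) (+-identityʳ k))

-- Since 2 e₂ = p₁² - p₂ and power sums commute, it suffices to cancel p₂ and halve.
M-B-comm : ∀ r g → M r (B g) ≗ B (M r g)
M-B-comm r g β = double-injective (+-cancelˡ-≡ (M 2 (M r g) β) _ _ (begin
  M 2 (M r g) β + (M r (B g) β + M r (B g) β) ≡⟨ cong₂ _+_ (M-comm 2 r g β) (sym (op-⊕ (decrs r) (B g) (B g) β)) ⟩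
  M r (M 2 g) β + M r (B g ⊕ B g) β ≡⟨ op-⊕ (decrs r) (M 2 g) (B g ⊕ B g) β ⟨
  M r (M 2 g ⊕ (B g ⊕ B g)) β ≡⟨ op-cong (decrs r) (M₁-square g) β ⟨
  M r (M 1 (M 1 g)) β ≡⟨ M-comm r 1 (M 1 g) β ⟩
  M 1 (M r (M 1 g)) β ≡⟨ op-cong (decrs 1) (M-comm r 1 g) β ⟩
  M 1 (M 1 (M r g)) β ≡⟨ M₁-square (M r g) β ⟩
  M 2 (M r g) β + (B (M r g) β + B (M r g) β) ∎))

A-cong : ∀ {f g} → f ≗ g → A f ≗ A g
A-cong = op-cong (λ β → decrs 2 β ++ dn β 2)

B-cong : ∀ {f g} → f ≗ g → B f ≗ B g
B-cong = op-cong (λ β → dn β 2)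

A-⊕ : ∀ f g → A (f ⊕ g) ≗ A f ⊕ A g
A-⊕ = op-⊕ (λ β → decrs 2 β ++ dn β 2)

B-⊕ : ∀ f g → B (f ⊕ g) ≗ B f ⊕ B g
B-⊕ = op-⊕ (λ β → dn β 2)

A-B-comm : ∀ g → A (B g) ≗ B (A g)
A-B-comm g β = begin
  A (B g) β ≡⟨ A-split (B g) β ⟩
  M 2 (B g) β + B (B g) β ≡⟨ cong (_+ B (B g) β) (M-B-comm 2 g β) ⟩
  B (M 2 g) β + B (B g) β ≡⟨ B-⊕ (M 2 g) (B g) β ⟨
  B (M 2 g ⊕ B g) β ≡⟨ B-cong (A-split g) β ⟨
  B (A g) β ∎

-- Even and odd parts of the powers of h₂ + e₂

-- (A + B)^k g = E k g + O k (B g): the parts of even and odd degree in B.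
E O : ℕ → Fn → Fn
E zero g = g
E (suc k) g = E k (A g) ⊕ O k (B (B g))
O zero g _ = 0
O (suc k) g = E k g ⊕ O k (A g)

E-cong : ∀ k {f g} → f ≗ g → E k f ≗ E k g
O-cong : ∀ k {f g} → f ≗ g → O k f ≗ O k g
E-cong zero e = e
E-cong (suc k) e β = cong₂ _+_ (E-cong k (A-cong e) β) (O-cong k (B-cong (B-cong e)) β)
O-cong zero e β = refl
O-cong (suc k) e β = cong₂ _+_ (E-cong k e β) (O-cong k (A-cong e) β)

E-⊕ : ∀ k f g → E k (f ⊕ g) ≗ E k f ⊕ E k g
O-⊕ : ∀ k f g → O k (f ⊕ g) ≗ O k f ⊕ O k g
E-⊕ zero f g β = refl
E-⊕ (suc k) f g β = trans
  (cong₂ _+_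
    (trans (E-cong k (A-⊕ f g) β) (E-⊕ k (A f) (A g) β))
    (trans (O-cong k (λ γ → trans (B-cong (B-⊕ f g) γ) (B-⊕ (B f) (B g) γ)) β) (O-⊕ k (B (B f)) (B (B g)) β)))
  (interchange (E k (A f) β) _ _ _)
O-⊕ zero f g β = refl
O-⊕ (suc k) f g β = trans
  (cong₂ _+_ (E-⊕ k f g β) (trans (O-cong k (A-⊕ f g) β) (O-⊕ k (A f) (A g) β)))
  (interchange (E k f β) _ _ _)

p₁² : ℕ → Fn → Fn
p₁² zero g = g
p₁² (suc k) g = p₁² k (M 1 (M 1 g))

p₁²-cong : ∀ k {f g} → f ≗ g → p₁² k f ≗ p₁² k g
p₁²-cong zero e = e
p₁²-cong (suc k) e = p₁²-cong k (op-cong (decrs 1) (op-cong (decrs 1) e))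

p₁²≗E⊕O : ∀ k g → p₁² k g ≗ E k g ⊕ O k (B g)
p₁²≗E⊕O zero g β = sym (+-identityʳ (g β))
p₁²≗E⊕O (suc k) g β = begin
  p₁² k (M 1 (M 1 g)) β ≡⟨ p₁²-cong k (M₁-square-AB g) β ⟩
  p₁² k (A g ⊕ B g) β ≡⟨ p₁²≗E⊕O k (A g ⊕ B g) β ⟩
  E k (A g ⊕ B g) β + O k (B (A g ⊕ B g)) β
    ≡⟨ cong₂ _+_ (E-⊕ k (A g) (B g) β) (trans (O-cong k (B-⊕ (A g) (B g)) β) (O-⊕ k (B (A g)) (B (B g)) β)) ⟩
  (E k (A g) β + E k (B g) β) + (O k (B (A g)) β + O k (B (B g)) β)
    -- `O (suc k) (B g)` unfolds to `O k (A (B g))`, with the opposite order of factors; here h₂ and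
    -- e₂ have to commute.
    ≡⟨ cong (λ t → (E k (A g) β + E k (B g) β) + (t + O k (B (B g)) β)) (O-cong k (A-B-comm g) β) ⟨
  (E k (A g) β + E k (B g) β) + (O k (A (B g)) β + O k (B (B g)) β)
    ≡⟨ rearrange (E k (A g) β) _ _ _ ⟩
  (E k (A g) β + O k (B (B g)) β) + (E k (B g) β + O k (A (B g)) β) ∎
  where
  rearrange : ∀ x y z w → (x + y) + (z + w) ≡ (x + w) + (y + z)
  rearrange = solve 4 (λ x y z w → (x :+ y) :+ (z :+ w) := (x :+ w) :+ (y :+ z)) refl
    where open +-*-Solver

-- Σ_{i ≤ k} p₁^{2(k-i)} p₂^i · g
geometric : ℕ → Fn → Fn
geometric zero g = g
geometric (suc k) g = p₁² (suc k) g ⊕ geometric k (M 2 g)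

geometric-cong : ∀ k {f g} → f ≗ g → geometric k f ≗ geometric k g
geometric-cong zero e = e
geometric-cong (suc k) e β = cong₂ _+_ (p₁²-cong (suc k) e β) (geometric-cong k (op-cong (decrs 2) e) β)

-- ((A + B)^{k+1} − (A − B)^{k+1}) / 2B has nonnegative coefficients.
geometric≗O : ∀ k g → geometric k g ≗ O (suc k) g
geometric≗O zero g β = sym (+-identityʳ (g β))
geometric≗O (suc k) g β = begin
  p₁² (suc k) g β + geometric k (M 2 g) β
    ≡⟨ cong₂ _+_ (p₁²≗E⊕O (suc k) g β) (geometric≗O k (M 2 g) β) ⟩
  (E (suc k) g β + O (suc k) (B g) β) + O (suc k) (M 2 g) β
    ≡⟨ trans (+-assoc (E (suc k) g β) _ _) (cong (E (suc k) g β +_) (+-comm (O (suc k) (B g) β) _)) ⟩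
  E (suc k) g β + (O (suc k) (M 2 g) β + O (suc k) (B g) β)
    -- The two odd parts merge by p₂ + e₂ = h₂, which leaves the recursion for `O (suc (suc k))`.
    ≡⟨ cong (E (suc k) g β +_) (trans (O-cong (suc k) (A-split g) β) (O-⊕ (suc k) (M 2 g) (B g) β)) ⟨
  E (suc k) g β + O (suc k) (A g) β ∎

p₁²-M : ∀ k r g → p₁² k (M r g) ≗ M r (p₁² k g)
p₁²-M zero r g β = refl
p₁²-M (suc k) r g β = trans
  (p₁²-cong k (λ γ → trans (op-cong (decrs 1) (M-comm 1 r g) γ) (M-comm 1 r (M 1 g) γ)) β)
  (p₁²-M k r (M 1 (M 1 g)) β)

geometric-M : ∀ k r g → geometric k (M r g) ≗ M r (geometric k g)
geometric-M zero r g β = refl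
geometric-M (suc k) r g β = begin
  p₁² (suc k) (M r g) β + geometric k (M 2 (M r g)) β
    ≡⟨ cong₂ _+_ (p₁²-M (suc k) r g β) (trans (geometric-cong k (M-comm 2 r g) β) (geometric-M k r (M 2 g) β)) ⟩
  M r (p₁² (suc k) g) β + M r (geometric k (M 2 g)) β ≡⟨ op-⊕ (decrs r) (p₁² (suc k) g) (geometric k (M 2 g)) β ⟨
  M r (p₁² (suc k) g ⊕ geometric k (M 2 g)) β ∎

-- Products of power sums with parts 1 and 2

pcoef-1s-+ : ∀ i lam → pcoef (replicate (i * 2) 1 ++ lam) ≗ p₁² i (pcoef lam)
pcoef-1s-+ zero lam β = refl
pcoef-1s-+ (suc i) lam β = trans (op-cong (decrs 1) (op-cong (decrs 1) (pcoef-1s-+ i lam)) β)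
  (sym (trans (p₁²-M i 1 (M 1 (pcoef lam)) β) (op-cong (decrs 1) (p₁²-M i 1 (pcoef lam)) β)))

replicate-+ : ∀ m n (x : ℕ) → replicate (m + n) x ≡ replicate m x ++ replicate n x
replicate-+ zero n x = refl
replicate-+ (suc m) n x = cong (x ∷_) (replicate-+ m n x)

pcoef-1s : ∀ i j → pcoef (replicate (i * 2 + j) 1) ≗ p₁² i (pcoef (replicate j 1))
pcoef-1s i j β = trans (cong (λ l → pcoef l β) (replicate-+ (i * 2) j 1)) (pcoef-1s-+ i (replicate j 1) β)

-- The partitions (2^i, 1^{2(k-i)+j}) for 0 ≤ i ≤ k.
twos : ℕ → ℕ → List (List ℕ)
twos zero j = [ replicate j 1 ]
twos (suc k) j = replicate (suc k * 2 + j) 1 ∷ map (2 ∷_) (twos k j)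

-- `twos` puts the parts 2 outermost, while `geometric` applies `M 2` to its argument; `geometric-M`
-- moves the factor.
∑-twos : ∀ k j β → ∑ (λ lam → pcoef lam β) (twos k j) ≡ geometric k (pcoef (replicate j 1)) β
∑-twos zero j β = +-identityʳ _
∑-twos (suc k) j β = cong₂ _+_ (pcoef-1s (suc k) j β) (begin
  ∑ (λ lam → pcoef lam β) (map (2 ∷_) (twos k j)) ≡⟨ ∑-map (λ lam → pcoef lam β) (2 ∷_) (twos k j) ⟩
  ∑ (λ lam → ∑ (pcoef lam) (decrs 2 β)) (twos k j) ≡⟨ ∑-swap pcoef (twos k j) (decrs 2 β) ⟩
  ∑ (λ γ → ∑ (λ lam → pcoef lam γ) (twos k j)) (decrs 2 β) ≡⟨ op-cong (decrs 2) (∑-twos k j) β ⟩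
  M 2 (geometric k (pcoef (replicate j 1))) β ≡⟨ geometric-M k 2 (pcoef (replicate j 1)) β ⟨
  geometric k (M 2 (pcoef (replicate j 1))) β ∎)

-- Comparison of K′ with the Kostka numbers

consPositive : ℕ → List ℕ → List ℕ
consPositive zero x = x
consPositive (suc k) x = suc k ∷ x

dropZeros-∷ : ∀ k κ → dropZeros (k ∷ κ) ≡ consPositive k (dropZeros κ)
dropZeros-∷ zero κ = refl
dropZeros-∷ (suc k) κ = refl

dropZeros-0∷ : ∀ l → dec (0 ∷ l) ≡ true → dropZeros l ≡ []
dropZeros-0∷ [] d = refl
dropZeros-0∷ (zero ∷ l) d = dropZeros-0∷ l d

-- Rows of zeros interlace only with zeros below the last positive row. `H` is arbitrary so that the
-- induction can absorb the first entry `k` into `H ∘ consPositive k`.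
∑-interl-dropZeros : ∀ ν → dec ν ≡ true → (H : Fn) →
  ∑ (H ∘ dropZeros) (interl (dropZeros ν)) ≡ ∑ (H ∘ dropZeros) (interl ν)
∑-interl-dropZeros [] d H = refl
∑-interl-dropZeros (zero ∷ []) d H = refl
∑-interl-dropZeros (suc a ∷ []) d H = refl
∑-interl-dropZeros (zero ∷ zero ∷ l) d H = begin
  ∑ (H ∘ dropZeros) (interl (dropZeros (zero ∷ l))) ≡⟨ ∑-interl-dropZeros (zero ∷ l) d H ⟩
  ∑ (H ∘ dropZeros) (interl (zero ∷ l)) ≡⟨ +-identityʳ _ ⟨
  ∑ (λ k → ∑ (H ∘ dropZeros ∘ (k ∷_)) (interl (zero ∷ l))) (range 0 0) ≡⟨ ∑-interl-∷ (H ∘ dropZeros) 0 0 l ⟨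
  ∑ (H ∘ dropZeros) (interl (zero ∷ zero ∷ l)) ∎
∑-interl-dropZeros (suc a ∷ zero ∷ l) d H = begin
  ∑ (H ∘ dropZeros) (interl (suc a ∷ dropZeros l)) ≡⟨ cong (λ t → ∑ (H ∘ dropZeros) (interl (suc a ∷ t))) (dropZeros-0∷ l d) ⟩
  ∑ (H ∘ dropZeros) (interl (suc a ∷ [])) ≡⟨ ∑-map (H ∘ dropZeros) (λ k → k ∷ []) (range 0 (suc a)) ⟩
  ∑ (λ k → H (dropZeros (k ∷ []))) (range 0 (suc a)) ≡⟨ ∑-cong (range 0 (suc a)) (row (∑-interl-dropZeros (zero ∷ l) d)) ⟩
  ∑ (λ k → ∑ (H ∘ dropZeros ∘ (k ∷_)) (interl (zero ∷ l))) (range 0 (suc a)) ≡⟨ ∑-interl-∷ (H ∘ dropZeros) (suc a) 0 l ⟨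
  ∑ (H ∘ dropZeros) (interl (suc a ∷ zero ∷ l)) ∎
  where
  row : (∀ H → ∑ (H ∘ dropZeros) (interl (dropZeros (zero ∷ l))) ≡ ∑ (H ∘ dropZeros) (interl (zero ∷ l))) →
    ∀ k → H (dropZeros (k ∷ [])) ≡ ∑ (H ∘ dropZeros ∘ (k ∷_)) (interl (zero ∷ l))
  row ih k = begin
    H (dropZeros (k ∷ [])) ≡⟨ +-identityʳ _ ⟨
    ∑ (H ∘ dropZeros ∘ (k ∷_)) (interl []) ≡⟨ ∑-cong (interl []) (cong H ∘ dropZeros-∷ k) ⟩
    ∑ (H ∘ consPositive k ∘ dropZeros) (interl []) ≡⟨ cong (∑ (H ∘ consPositive k ∘ dropZeros) ∘ interl) (dropZeros-0∷ l d) ⟨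
    ∑ (H ∘ consPositive k ∘ dropZeros) (interl (dropZeros (zero ∷ l)))
      ≡⟨ ih (H ∘ consPositive k) ⟩
    ∑ (H ∘ consPositive k ∘ dropZeros) (interl (zero ∷ l)) ≡⟨ ∑-cong (interl (zero ∷ l)) (cong H ∘ dropZeros-∷ k) ⟨
    ∑ (H ∘ dropZeros ∘ (k ∷_)) (interl (zero ∷ l)) ∎
∑-interl-dropZeros (suc a ∷ suc b ∷ l) d H = begin
  ∑ (H ∘ dropZeros) (interl (suc a ∷ suc b ∷ dropZeros l)) ≡⟨ ∑-interl-∷ (H ∘ dropZeros) (suc a) (suc b) (dropZeros l) ⟩
  ∑ (λ k → ∑ (H ∘ dropZeros ∘ (k ∷_)) (interl (dropZeros (suc b ∷ l)))) (range (suc b) (suc a))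
    ≡⟨ ∑-cong (range (suc b) (suc a)) (λ k → begin
         _ ≡⟨ ∑-cong (interl (dropZeros (suc b ∷ l))) (cong H ∘ dropZeros-∷ k) ⟩
         _ ≡⟨ ∑-interl-dropZeros (suc b ∷ l) (dec-tail (suc a) (suc b ∷ l) d) (H ∘ consPositive k) ⟩
         _ ≡⟨ ∑-cong (interl (suc b ∷ l)) (cong H ∘ dropZeros-∷ k) ⟨
         ∑ (H ∘ dropZeros ∘ (k ∷_)) (interl (suc b ∷ l)) ∎) ⟩
  ∑ (λ k → ∑ (H ∘ dropZeros ∘ (k ∷_)) (interl (suc b ∷ l))) (range (suc b) (suc a))
    ≡⟨ ∑-interl-∷ (H ∘ dropZeros) (suc a) (suc b) l ⟨
  ∑ (H ∘ dropZeros) (interl (suc a ∷ suc b ∷ l)) ∎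

sum-dropZeros : ∀ ν → sum (dropZeros ν) ≡ sum ν
sum-dropZeros [] = refl
sum-dropZeros (zero ∷ ν) = sum-dropZeros ν
sum-dropZeros (suc a ∷ ν) = cong (suc a +_) (sum-dropZeros ν)

kostkaRev≡K′ : ∀ β ν → dec ν ≡ true → kostkaRev (dropZeros ν) β ≡ K′ ν β
kostkaRev≡K′ [] ν d = null-sum ν
  where
  open import Data.List using (null)
  null-sum : ∀ ν → (if null (dropZeros ν) then 1 else 0) ≡ (if sum ν ≡ᵇ 0 then 1 else 0)
  null-sum [] = refl
  null-sum (zero ∷ ν) = null-sum ν
  null-sum (suc a ∷ ν) = refl
kostkaRev≡K′ (a ∷ β) ν d = begin
  ∑ (λ κ → gate (sum (dropZeros ν) ≡ᵇ sum κ + a) (kostkaRev (dropZeros κ) β)) (interl (dropZeros ν))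
    ≡⟨ ∑-cong (interl (dropZeros ν)) (λ κ → cong₂ (λ s t → gate (s ≡ᵇ t + a) (kostkaRev (dropZeros κ) β))
         (sum-dropZeros ν) (sym (sum-dropZeros κ))) ⟩
  ∑ (H ∘ dropZeros) (interl (dropZeros ν)) ≡⟨ ∑-interl-dropZeros ν d H ⟩
  ∑ (H ∘ dropZeros) (interl ν)
    ≡⟨ ∑-cong-∈ (interl ν) (λ κ κ∈ → cong₂ (λ s t → gate (sum ν ≡ᵇ s + a) t)
         (sum-dropZeros κ) (kostkaRev≡K′ β κ (interl-dec ν κ∈))) ⟩
  K′ ν (a ∷ β) ∎
  where
  H : Fn
  H x = gate (sum ν ≡ᵇ sum x + a) (kostkaRev x β)

K′-dropZeros-cong : ∀ ν ν′ → dec ν ≡ true → dec ν′ ≡ true → dropZeros ν ≡ dropZeros ν′ → K′ ν ≗ K′ ν′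
K′-dropZeros-cong ν ν′ d d′ e β =
  trans (sym (kostkaRev≡K′ β ν d)) (trans (cong (λ x → kostkaRev x β) e) (kostkaRev≡K′ β ν′ d′))

-- Schur-positive functions

-- K′ peels off the largest variable first, so KL xs β is the coefficient
-- of the monomial with exponent vector reverse β.
KL : List (List ℕ) → Fn
KL xs β = ∑ (λ ν → K′ ν β) xs

-- A sum of Schur functions as a plain list of shapes: degree and length are left free, and entries
-- that are not decreasing contribute 0.
Pos : Fn → Set
Pos f = ∃ λ xs → f ≗ KL xs

KL-++ : ∀ xs ys → KL (xs ++ ys) ≗ KL xs ⊕ KL ys
KL-++ xs ys β = ∑-++ (λ ν → K′ ν β) xs ys

KL-decreasing : ∀ xs → KL xs ≗ KL (filterᵇ dec xs)
KL-decreasing xs β = trans (∑-cong xs gated) (sym (∑-filterᵇ (λ ν → K′ ν β) dec xs))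
  where
  gated : ∀ ν → K′ ν β ≡ gate (dec ν) (K′ ν β)
  gated ν with dec ν in d
  ... | true = refl
  ... | false = K′-nondec ν β d

∈-filterᵇ : ∀ (p : X → Bool) {x} xs → x ∈ filterᵇ p xs → (x ∈ xs) × (p x ≡ true)
∈-filterᵇ p (y ∷ ys) x∈ with p y in e
∈-filterᵇ p (y ∷ ys) (here refl) | true = here refl , e
∈-filterᵇ p (y ∷ ys) (there x∈) | true = there (proj₁ (∈-filterᵇ p ys x∈)) , proj₂ (∈-filterᵇ p ys x∈)
... | false = there (proj₁ (∈-filterᵇ p ys x∈)) , proj₂ (∈-filterᵇ p ys x∈)

KL-map : ∀ (h : List ℕ → List ℕ) xs → (∀ ν → dec ν ≡ true → dec (h ν) ≡ true) →
  (∀ ν → dec ν ≡ true → dropZeros (h ν) ≡ dropZeros ν) → KL xs ≗ KL (map h (filterᵇ dec xs))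
KL-map h xs hd hz β = begin
  KL xs β ≡⟨ KL-decreasing xs β ⟩
  KL (filterᵇ dec xs) β ≡⟨ ∑-cong-∈ (filterᵇ dec xs) (λ ν ν∈ → let d = proj₂ (∈-filterᵇ dec xs ν∈) in
      K′-dropZeros-cong (h ν) ν (hd ν d) d (hz ν d) β) ⟨
  ∑ (λ ν → K′ (h ν) β) (filterᵇ dec xs) ≡⟨ ∑-map (λ ν → K′ ν β) h (filterᵇ dec xs) ⟨
  KL (map h (filterᵇ dec xs)) β ∎

padded-++ : ∀ ν → dec ν ≡ true → Padded 000s (ν ++ 000s)
padded-++ [] d = base
padded-++ (a ∷ []) d = cons z≤n base
padded-++ (a ∷ b ∷ l) d = cons (dec-head a b l d) (padded-++ (b ∷ l) (dec-tail a (b ∷ l) d))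

dropZeros-++ : ∀ ν → dropZeros (ν ++ 000s) ≡ dropZeros ν
dropZeros-++ [] = refl
dropZeros-++ (zero ∷ ν) = dropZeros-++ ν
dropZeros-++ (suc a ∷ ν) = cong (suc a ∷_) (dropZeros-++ ν)

dropZeros-dec : ∀ ν → dec ν ≡ true → dec (dropZeros ν) ≡ true
dropZeros-dec [] d = refl
dropZeros-dec (zero ∷ ν) d rewrite dropZeros-0∷ ν d = refl
dropZeros-dec (suc a ∷ []) d = refl
dropZeros-dec (suc a ∷ zero ∷ l) d rewrite dropZeros-0∷ l d = refl
dropZeros-dec (suc a ∷ suc b ∷ l) d =
  dec-∷ {l = dropZeros l} (dec-head (suc a) (suc b) l d) (dropZeros-dec (suc b ∷ l) (dec-tail (suc a) (suc b ∷ l) d))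

dropZeros-idem : ∀ ν → dropZeros (dropZeros ν) ≡ dropZeros ν
dropZeros-idem [] = refl
dropZeros-idem (zero ∷ ν) = dropZeros-idem ν
dropZeros-idem (suc a ∷ ν) = cong (suc a ∷_) (dropZeros-idem ν)

-- `pad` opens the empty rows that the Pieri rules require; `trim` restores the canonical form of
-- each partition, so that shapes can be compared literally.
pad trim : List (List ℕ) → List (List ℕ)
pad xs = map (_++ 000s) (filterᵇ dec xs)
trim xs = map dropZeros (filterᵇ dec xs)

KL-pad : ∀ xs → KL xs ≗ KL (pad xs)
KL-pad xs = KL-map (_++ 000s) xs (λ ν d → padded-dec (padded-weaken (padded-++ ν d))) (λ ν _ → dropZeros-++ ν)

KL-trim : ∀ xs → KL xs ≗ KL (trim xs)
KL-trim xs = KL-map dropZeros xs dropZeros-dec (λ ν _ → dropZeros-idem ν)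

∈-pad : ∀ {ν} xs → ν ∈ pad xs → Padded 000s ν
∈-pad xs ν∈ with ∈-map⁻ (_++ 000s) ν∈
... | ν′ , ν′∈ , refl = padded-++ ν′ (proj₂ (∈-filterᵇ dec xs ν′∈))

extend : (List ℕ → List (List ℕ)) → List (List ℕ) → List (List ℕ)
extend step xs = trim (concatMap step (pad xs))

op-KL : ∀ T step → (∀ ν → Padded 000s ν → op T (K′ ν) ≗ KL (step ν)) → ∀ xs →
  op T (KL xs) ≗ KL (extend step xs)
op-KL T step rule xs β = begin
  op T (KL xs) β ≡⟨ op-cong T (KL-pad xs) β ⟩
  op T (KL (pad xs)) β ≡⟨ ∑-swap (λ γ ν → K′ ν γ) (T β) (pad xs) ⟩
  ∑ (λ ν → op T (K′ ν) β) (pad xs) ≡⟨ ∑-cong-∈ (pad xs) (λ ν ν∈ → rule ν (∈-pad xs ν∈) β) ⟩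
  ∑ (λ ν → KL (step ν) β) (pad xs) ≡⟨ ∑-concatMap (λ ν → K′ ν β) step (pad xs) ⟨
  KL (concatMap step (pad xs)) β ≡⟨ KL-trim (concatMap step (pad xs)) β ⟩
  KL (extend step xs) β ∎

M₁-K′ : ∀ ν → Padded 00s ν → M 1 (K′ ν) ≗ KL (vstrips ν 1)
M₁-K′ ν p β = trans (sym (dn-1 (K′ ν) β)) (pieri β p 1 (s≤s z≤n))

B-K′ : ∀ ν → Padded 00s ν → B (K′ ν) ≗ KL (vstrips ν 2)
B-K′ ν p β = pieri β p 2 ≤-refl

A-K′ : ∀ ν → Padded 000s ν → A (K′ ν) ≗ KL (hstrips ν)
A-K′ ν p β = +-cancelʳ-≡ (B (K′ ν) β) (A (K′ ν) β) (KL (hstrips ν) β) (begin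
  A (K′ ν) β + B (K′ ν) β ≡⟨ M₁-square-AB (K′ ν) β ⟨
  -- After the first box only decreasing shapes are kept, because the Pieri rule for the second box
  -- applies to padded decreasing shapes.
  M 1 (M 1 (K′ ν)) β ≡⟨ op-cong (decrs 1) (λ γ → trans (M₁-K′ ν p₂ γ) (KL-gate γ)) β ⟩
  ∑ (λ γ → ∑ (λ ρ → gate (dec ρ) (K′ ρ γ)) (vstrips ν 1)) (decrs 1 β) ≡⟨ ∑-swap _ (decrs 1 β) (vstrips ν 1) ⟩
  ∑ (λ ρ → ∑ (λ γ → gate (dec ρ) (K′ ρ γ)) (decrs 1 β)) (vstrips ν 1)
    ≡⟨ ∑-cong-∈ (vstrips ν 1) (λ ρ ρ∈ → trans (∑-gate (dec ρ) (K′ ρ) (decrs 1 β)) (second ρ ρ∈)) ⟩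
  ∑ (λ ρ → gate (dec ρ) (KL (vstrips ρ 1) β)) (vstrips ν 1)
    ≡⟨ ∑-two-boxes (λ σ → K′ σ β) (λ σ → K′-nondec σ β) ν (padded-dec p₂) ⟩
  KL (vstrips ν 2) β + KL (hstrips ν) β ≡⟨ +-comm (KL (vstrips ν 2) β) _ ⟩
  KL (hstrips ν) β + KL (vstrips ν 2) β ≡⟨ cong (KL (hstrips ν) β +_) (B-K′ ν p₂ β) ⟨
  KL (hstrips ν) β + B (K′ ν) β ∎)
  where
  p₂ = padded-weaken p
  KL-gate : ∀ γ → KL (vstrips ν 1) γ ≡ ∑ (λ ρ → gate (dec ρ) (K′ ρ γ)) (vstrips ν 1)
  KL-gate γ = trans (KL-decreasing (vstrips ν 1) γ) (∑-filterᵇ (λ ρ → K′ ρ γ) dec (vstrips ν 1))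
  second : ∀ ρ → ρ ∈ vstrips ν 1 → gate (dec ρ) (M 1 (K′ ρ) β) ≡ gate (dec ρ) (KL (vstrips ρ 1) β)
  second ρ ρ∈ with dec ρ in d
  ... | true = M₁-K′ ρ (padded-box p ρ∈ d) β
  ... | false = refl

addBox addV₂ addH₂ : List (List ℕ) → List (List ℕ)
addBox = extend (λ ν → vstrips ν 1)
addV₂ = extend (λ ν → vstrips ν 2)
addH₂ = extend hstrips

M₁-KL : ∀ xs → M 1 (KL xs) ≗ KL (addBox xs)
M₁-KL = op-KL (decrs 1) _ (λ ν p → M₁-K′ ν (padded-weaken p))

B-KL : ∀ xs → B (KL xs) ≗ KL (addV₂ xs)
B-KL = op-KL (λ β → dn β 2) _ (λ ν p → B-K′ ν (padded-weaken p))

A-KL : ∀ xs → A (KL xs) ≗ KL (addH₂ xs)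
A-KL = op-KL (λ β → decrs 2 β ++ dn β 2) _ A-K′

-- Closure properties of Schur positivity

pos-resp : ∀ {f g} → f ≗ g → Pos g → Pos f
pos-resp e (xs , r) = xs , λ β → trans (e β) (r β)

pos-⊕ : ∀ {f g} → Pos f → Pos g → Pos (f ⊕ g)
pos-⊕ (xs , r) (ys , s) = xs ++ ys , λ β → trans (cong₂ _+_ (r β) (s β)) (sym (KL-++ xs ys β))

pos-M₁ : ∀ {f} → Pos f → Pos (M 1 f)
pos-M₁ (xs , r) = addBox xs , λ β → trans (op-cong (decrs 1) r β) (M₁-KL xs β)

pos-A : ∀ {f} → Pos f → Pos (A f)
pos-A (xs , r) = addH₂ xs , λ β → trans (A-cong r β) (A-KL xs β)

pos-B : ∀ {f} → Pos f → Pos (B f)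
pos-B (xs , r) = addV₂ xs , λ β → trans (B-cong r β) (B-KL xs β)

pos-E : ∀ k {f} → Pos f → Pos (E k f)
pos-O : ∀ k {f} → Pos f → Pos (O k f)
pos-E zero p = p
pos-E (suc k) p = pos-⊕ (pos-E k (pos-A p)) (pos-O k (pos-B (pos-B p)))
pos-O zero p = [] , λ _ → refl
pos-O (suc k) p = pos-⊕ (pos-E k p) (pos-O k (pos-A p))

-- Elements of low degree

eqL : List ℕ → List ℕ → Bool
eqL [] [] = true
eqL [] (_ ∷ _) = false
eqL (_ ∷ _) [] = false
eqL (a ∷ x) (b ∷ y) = (a ≡ᵇ b) ∧ eqL x y

eqL-sound : ∀ x y → eqL x y ≡ true → x ≡ y
eqL-sound [] [] _ = refl
eqL-sound (a ∷ x) (b ∷ y) e with ∧-true {a ≡ᵇ b} e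
... | p , q = cong₂ _∷_ (≡ᵇ⇒≡ a b (subst T (sym p) tt)) (eqL-sound x y q)

elem : List ℕ → List (List ℕ) → Bool
elem x [] = false
elem x (y ∷ ys) = eqL x y ∨ elem x ys

remove : List ℕ → List (List ℕ) → List (List ℕ)
remove x [] = []
remove x (y ∷ ys) = if eqL x y then ys else y ∷ remove x ys

∑-remove : ∀ (f : Fn) x ys → elem x ys ≡ true → ∑ f ys ≡ f x + ∑ f (remove x ys)
∑-remove f x (y ∷ ys) e with eqL x y in q
... | true = cong (λ z → f z + ∑ f ys) (sym (eqL-sound x y q))
... | false = trans (cong (f y +_) (∑-remove f x ys e)) (x∙yz≈y∙xz (f y) (f x) _)

removeAll : List (List ℕ) → List (List ℕ) → List (List ℕ)
removeAll [] ys = ys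
removeAll (x ∷ xs) ys = removeAll xs (remove x ys)

-- Inclusion of multisets, as a boolean, so that the checks in low degree close by `refl`.
contained : List (List ℕ) → List (List ℕ) → Bool
contained [] ys = true
contained (x ∷ xs) ys = elem x ys ∧ contained xs (remove x ys)

∑-removeAll : ∀ (f : Fn) xs ys → contained xs ys ≡ true → ∑ f ys ≡ ∑ f xs + ∑ f (removeAll xs ys)
∑-removeAll f [] ys _ = refl
∑-removeAll f (x ∷ xs) ys c with ∧-true {elem x ys} c
... | e , c′ = trans (∑-remove f x ys e)
  (trans (cong (f x +_) (∑-removeAll f xs (remove x ys) c′)) (sym (+-assoc (f x) _ _)))

-- f = KL ys − KL xs without subtraction.
record Diff (f : Fn) (xs ys : List (List ℕ)) : Set where
  constructor mkDiff
  field
    equation : f ⊕ KL xs ≗ KL ys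

diff⇒pos : ∀ {f xs ys} → Diff f xs ys → contained xs ys ≡ true → Pos f
diff⇒pos {f} {xs} {ys} (mkDiff d) c = removeAll xs ys , λ β → +-cancelʳ-≡ (KL xs β) (f β) _
  (trans (d β) (trans (∑-removeAll (λ ν → K′ ν β) xs ys c) (+-comm (KL xs β) _)))

diff-⊕ : ∀ {f g xs ys us vs} → Diff f xs ys → Diff g us vs → Diff (f ⊕ g) (xs ++ us) (ys ++ vs)
diff-⊕ {f} {g} {xs} {ys} {us} {vs} (mkDiff d) (mkDiff e) = mkDiff λ β → begin
  (f β + g β) + KL (xs ++ us) β ≡⟨ cong ((f β + g β) +_) (KL-++ xs us β) ⟩
  (f β + g β) + (KL xs β + KL us β) ≡⟨ interchange (f β) _ _ _ ⟩
  (f β + KL xs β) + (g β + KL us β) ≡⟨ cong₂ _+_ (d β) (e β) ⟩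
  KL ys β + KL vs β ≡⟨ KL-++ ys vs β ⟨
  KL (ys ++ vs) β ∎

diff-op : ∀ T (add : List (List ℕ) → List (List ℕ)) → (∀ zs → op T (KL zs) ≗ KL (add zs)) →
  ∀ {f xs ys} → Diff f xs ys → Diff (op T f) (add xs) (add ys)
diff-op T add rule {f} {xs} {ys} (mkDiff d) = mkDiff λ β → begin
  op T f β + KL (add xs) β ≡⟨ cong (op T f β +_) (rule xs β) ⟨
  op T f β + op T (KL xs) β ≡⟨ op-⊕ T f (KL xs) β ⟨
  op T (f ⊕ KL xs) β ≡⟨ op-cong T d β ⟩
  op T (KL ys) β ≡⟨ rule ys β ⟩
  KL (add ys) β ∎

one p₁ p₃ : Fn
one = pcoef []
p₁ = pcoef (1 ∷ [])
p₃ = pcoef (3 ∷ [])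

K′-[] : K′ [] ≗ one
K′-[] [] = refl
K′-[] (zero ∷ β) = trans (+-identityʳ _) (K′-[] β)
K′-[] (suc a ∷ β) = refl

diff-one : Diff one [] [ [] ]
diff-one = mkDiff λ β → cong (_+ 0) (sym (K′-[] β))

p₃-∷ : ∀ a β → p₃ (a ∷ β) ≡ lower 3 a (λ a′ → one (a′ ∷ β)) + M 3 (one ∘ (a ∷_)) β
p₃-∷ = M-∷ 3 one

p₃-suc∷ : ∀ a β → p₃ (suc a ∷ β) ≡ lower 3 (suc a) (λ a′ → one (a′ ∷ β))
p₃-suc∷ a β = trans (p₃-∷ (suc a) β) (trans (cong (lower 3 (suc a) (λ a′ → one (a′ ∷ β)) +_) (∑-0 (decrs 3 β))) (+-identityʳ _))

-- p₃ = s₃ − s₂₁ + s₁₁₁, by splitting off one variable.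
p₃-equation : p₃ ⊕ KL [ 2 ∷ 1 ∷ [] ] ≗ KL ((3 ∷ []) ∷ (1 ∷ 1 ∷ 1 ∷ []) ∷ [])
p₃-equation [] = refl
p₃-equation (0 ∷ β) = trans (cong₂ _+_ (p₃-∷ 0 β) (+-identityʳ (KL [ 2 ∷ 1 ∷ [] ] β)))
  (trans (p₃-equation β) (cong₂ (λ x y → x + (y + 0)) (sym (+-identityʳ (K′ (3 ∷ []) β))) (sym (+-identityʳ (K′ (1 ∷ 1 ∷ 1 ∷ []) β)))))
-- At exponent 1 of the split variable, s₃ branches to s₂, s₂₁ to s₂ + s₁₁ and s₁₁₁ to s₁₁, while p₃
-- contributes 0.
p₃-equation (1 ∷ β) = trans (cong (_+ KL [ 2 ∷ 1 ∷ [] ] (1 ∷ β)) (p₃-suc∷ 0 β))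
  (trans (regroup (K′ (1 ∷ 1 ∷ []) β) (K′ (2 ∷ 0 ∷ []) β))
    (cong₂ (λ x y → (x + 0) + ((y + 0) + 0))
      (K′-dropZeros-cong (2 ∷ 0 ∷ []) (2 ∷ []) refl refl refl β)
      (K′-dropZeros-cong (1 ∷ 1 ∷ []) (1 ∷ 1 ∷ 0 ∷ []) refl refl refl β)))
  where
  regroup : ∀ x y → (x + (y + 0)) + 0 ≡ (y + 0) + ((x + 0) + 0)
  regroup = solve 2 (λ x y → (x :+ (y :+ con 0)) :+ con 0 := (y :+ con 0) :+ ((x :+ con 0) :+ con 0)) refl
    where open +-*-Solver
p₃-equation (2 ∷ β) = trans (cong (_+ KL [ 2 ∷ 1 ∷ [] ] (2 ∷ β)) (p₃-suc∷ 1 β))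
  (cong (λ x → (x + 0) + 0) (K′-dropZeros-cong (1 ∷ 0 ∷ []) (1 ∷ []) refl refl refl β))
p₃-equation (3 ∷ β) = trans (cong (_+ KL [ 2 ∷ 1 ∷ [] ] (3 ∷ β)) (p₃-suc∷ 2 β))
  (cong (_+ 0) (trans (sym (trans (K′-dropZeros-cong (0 ∷ []) [] refl refl refl β) (K′-[] β))) (sym (+-identityʳ _))))
p₃-equation (suc (suc (suc (suc a))) ∷ β) = cong (_+ 0) (p₃-suc∷ (3 + a) β)

diff-p₃ : Diff p₃ [ 2 ∷ 1 ∷ [] ] ((3 ∷ []) ∷ (1 ∷ 1 ∷ 1 ∷ []) ∷ [])
diff-p₃ = mkDiff p₃-equation

diff-A : ∀ {f xs ys} → Diff f xs ys → Diff (A f) (addH₂ xs) (addH₂ ys)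
diff-A = diff-op (λ β → decrs 2 β ++ dn β 2) addH₂ A-KL

diff-B : ∀ {f xs ys} → Diff f xs ys → Diff (B f) (addV₂ xs) (addV₂ ys)
diff-B = diff-op (λ β → dn β 2) addV₂ B-KL

diff-M₁ : ∀ {f xs ys} → Diff f xs ys → Diff (M 1 f) (addBox xs) (addBox ys)
diff-M₁ = diff-op (decrs 1) addBox M₁-KL

diff-p₁ : Diff p₁ (addBox []) (addBox [ [] ])
diff-p₁ = diff-M₁ diff-one

pos-one : Pos one
pos-one = diff⇒pos diff-one refl

-- 3 s₃ + s₂₁ + s₁₁₁
pos₃ : Pos (p₃ ⊕ A p₁ ⊕ A p₁)
pos₃ = diff⇒pos (diff-⊕ (diff-⊕ diff-p₃ Ap₁) Ap₁) refl
  where Ap₁ = diff-A diff-p₁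

-- Here e₂ p₃ = s₄₁ - s₃₂ + s₁₁₁₁₁, and h₂² p₁ contains s₃₂.
pos₅ : Pos (B p₃ ⊕ B (B p₁) ⊕ A (A p₁))
pos₅ = diff⇒pos (diff-⊕ (diff-⊕ (diff-B diff-p₃) (diff-B (diff-B diff-p₁)))
  (diff-A (diff-A diff-p₁))) refl

-- Here p₁ p₃ = s₄ - s₂₂ + s₁₁₁₁, and h₂² contains s₂₂.
pos₄ : Pos (M 1 p₃ ⊕ A (A one) ⊕ B (B one))
pos₄ = diff⇒pos (diff-⊕ (diff-⊕ (diff-M₁ diff-p₃) (diff-A (diff-A diff-one)))
  (diff-B (diff-B diff-one))) refl

-- The negative part e₂ s₂₂ = s₃₃ + s₃₂₁ + s₂₂₁₁ of e₂ p₁ p₃ is absorbed by h₂³ + h₂ e₂².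
pos₆ : Pos (B (M 1 p₃) ⊕ A (B (B one)) ⊕ A (A (A one)))
pos₆ = diff⇒pos (diff-⊕ (diff-⊕ (diff-B (diff-M₁ diff-p₃)) (diff-A (diff-B (diff-B diff-one))))
  (diff-A (diff-A (diff-A diff-one)))) refl

-- Positivity of the sums over both kinds of intervals

pos-1s : ∀ j → Pos (pcoef (replicate j 1))
pos-1s zero = pos-one
pos-1s (suc j) = pos-M₁ (pos-1s j)

pos-twos : ∀ k j → Pos (λ β → ∑ (λ lam → pcoef lam β) (twos k j))
pos-twos k j = pos-resp (λ β → trans (∑-twos k j β) (geometric≗O k (pcoef (replicate j 1)) β)) (pos-O (suc k) (pos-1s j))

threeOnes-odd : ∀ k → pcoef (3 ∷ replicate (k * 2 + 0) 1) ≗ p₁² k p₃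
threeOnes-odd k β = trans (op-cong (decrs 3) (pcoef-1s k 0) β) (sym (p₁²-M k 3 one β))

threeOnes-even : ∀ k → pcoef (3 ∷ replicate (k * 2 + 1) 1) ≗ p₁² k (M 1 p₃)
threeOnes-even k β = begin
  M 3 (pcoef (replicate (k * 2 + 1) 1)) β ≡⟨ op-cong (decrs 3) (pcoef-1s k 1) β ⟩
  M 3 (p₁² k p₁) β ≡⟨ p₁²-M k 3 p₁ β ⟨
  p₁² k (M 3 p₁) β ≡⟨ p₁²-cong k (M-comm 3 1 one) β ⟩
  p₁² k (M 1 p₃) β ∎

-- In terms of the even part E and odd part O of (A + B)^k, both sums below
-- become E k f ⊕ O k g with f and g of degree at most 6.
pos-three-odd : ∀ k → Pos (p₁² k p₃ ⊕ geometric (1 + k) p₁)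
pos-three-odd k = pos-resp split (pos-⊕ (pos-E k pos₃) (pos-O k pos₅))
  where
  rearrange : ∀ a b c d e → (a + b) + ((c + d) + (c + e)) ≡ ((a + c) + c) + ((b + d) + e)
  rearrange = solve 5 (λ a b c d e → (a :+ b) :+ ((c :+ d) :+ (c :+ e)) := ((a :+ c) :+ c) :+ ((b :+ d) :+ e)) refl
    where open +-*-Solver
  split : p₁² k p₃ ⊕ geometric (1 + k) p₁ ≗ E k (p₃ ⊕ A p₁ ⊕ A p₁) ⊕ O k (B p₃ ⊕ B (B p₁) ⊕ A (A p₁))
  split β = begin
    p₁² k p₃ β + geometric (1 + k) p₁ β ≡⟨ cong₂ _+_ (p₁²≗E⊕O k p₃ β) (geometric≗O (1 + k) p₁ β) ⟩
    (E k p₃ β + O k (B p₃) β) + ((E k (A p₁) β + O k (B (B p₁)) β) + (E k (A p₁) β + O k (A (A p₁)) β))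
      ≡⟨ rearrange (E k p₃ β) _ _ _ _ ⟩
    ((E k p₃ β + E k (A p₁) β) + E k (A p₁) β) + ((O k (B p₃) β + O k (B (B p₁)) β) + O k (A (A p₁)) β)
      ≡⟨ cong₂ _+_
           (trans (E-⊕ k (p₃ ⊕ A p₁) (A p₁) β) (cong (_+ E k (A p₁) β) (E-⊕ k p₃ (A p₁) β)))
           (trans (O-⊕ k (B p₃ ⊕ B (B p₁)) (A (A p₁)) β) (cong (_+ O k (A (A p₁)) β) (O-⊕ k (B p₃) (B (B p₁)) β))) ⟨
    E k (p₃ ⊕ A p₁ ⊕ A p₁) β + O k (B p₃ ⊕ B (B p₁) ⊕ A (A p₁)) β ∎

pos-three-even : ∀ k → Pos (p₁² k (M 1 p₃) ⊕ geometric (2 + k) one)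
pos-three-even k = pos-resp split (pos-⊕
  (pos-⊕ (pos-E k pos₄) (pos-⊕ (pos-E k posAA) (pos-E k posAA)))
  (pos-⊕ (pos-O k pos₆) (pos-⊕ (pos-O k posBBA) (pos-O k posBBA))))
  where
  -- One of the three copies of h₂² goes into `pos₄` and one of the three of h₂ e₂² into `pos₆`; the
  -- other two of each are positive by themselves.
  posAA = pos-A (pos-A pos-one)
  posBBA = pos-B (pos-B (pos-A pos-one))
  AA = E k (A (A one))
  BB = E k (B (B one))
  -- `BBA` and `ABB` come from the same product h₂ e₂²; unfolding `O (3 + k)` yields it in both
  -- orders.
  BBA = O k (B (B (A one)))
  ABB = O k (A (B (B one)))
  AAA = O k (A (A (A one)))
  rearrange : ∀ p q aa bb bba abb aaa →
    (p + q) + (((aa + bba) + (bb + abb)) + ((aa + bba) + (aa + aaa))) ≡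
    (((p + aa) + bb) + (aa + aa)) + (((q + abb) + aaa) + (bba + bba))
  rearrange = solve 7 (λ p q aa bb bba abb aaa →
    (p :+ q) :+ (((aa :+ bba) :+ (bb :+ abb)) :+ ((aa :+ bba) :+ (aa :+ aaa))) :=
    (((p :+ aa) :+ bb) :+ (aa :+ aa)) :+ (((q :+ abb) :+ aaa) :+ (bba :+ bba))) refl
    where open +-*-Solver
  split : p₁² k (M 1 p₃) ⊕ geometric (2 + k) one ≗
    (E k (M 1 p₃ ⊕ A (A one) ⊕ B (B one)) ⊕ (AA ⊕ AA)) ⊕
    (O k (B (M 1 p₃) ⊕ A (B (B one)) ⊕ A (A (A one))) ⊕ (BBA ⊕ BBA))
  split β = begin
    p₁² k (M 1 p₃) β + geometric (2 + k) one β ≡⟨ cong₂ _+_ (p₁²≗E⊕O k (M 1 p₃) β) (geometric≗O (2 + k) one β) ⟩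
    (E k (M 1 p₃) β + O k (B (M 1 p₃)) β) + (((AA β + BBA β) + (BB β + ABB β)) + ((AA β + BBA β) + (AA β + AAA β)))
      ≡⟨ rearrange (E k (M 1 p₃) β) (O k (B (M 1 p₃)) β) (AA β) (BB β) (BBA β) (ABB β) (AAA β) ⟩
    (((E k (M 1 p₃) β + AA β) + BB β) + (AA β + AA β)) + (((O k (B (M 1 p₃)) β + ABB β) + AAA β) + (BBA β + BBA β))
      ≡⟨ cong₂ _+_
           (cong (_+ (AA β + AA β))
             (trans (E-⊕ k (M 1 p₃ ⊕ A (A one)) (B (B one)) β) (cong (_+ BB β) (E-⊕ k (M 1 p₃) (A (A one)) β))))
           (cong (_+ (BBA β + BBA β))
             (trans (O-⊕ k (B (M 1 p₃) ⊕ A (B (B one))) (A (A (A one))) β)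
               (cong (_+ AAA β) (O-⊕ k (B (M 1 p₃)) (A (B (B one))) β)))) ⟨
    _ ∎

-- The case `j = 1` is n = 2m + 3; for `j = 0` and `suc m` it is n = 2m + 4, and `j = 0`, `m = 0`
-- would mean n = 2.
pos-three-twos : ∀ m j → j ≤ 1 → 3 ≤ suc m * 2 + j →
  Pos (λ β → ∑ (λ lam → pcoef lam β) (threeOnes (suc m * 2 + j) ∷ twos (suc m) j))
pos-three-twos m 1 _ _ = pos-resp
  (λ β → cong₂ _+_ (trans (cong (λ t → pcoef (3 ∷ replicate t 1) β) (shift m)) (threeOnes-odd m β)) (∑-twos (suc m) 1 β))
  (pos-three-odd m)
  where
  shift : ∀ m → m * 2 + 1 ∸ 1 ≡ m * 2 + 0
  shift m = trans (m+n∸n≡m (m * 2) 1) (sym (+-identityʳ (m * 2)))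
pos-three-twos (suc m) 0 _ _ = pos-resp
  (λ β → cong₂ _+_ (trans (cong (λ t → pcoef (3 ∷ replicate t 1) β) (shift m)) (threeOnes-even m β)) (∑-twos (2 + m) 0 β))
  (pos-three-even m)
  where
  shift : ∀ m → suc (m * 2 + 0) ≡ m * 2 + 1
  shift m = sym (+-suc (m * 2) 0)
pos-three-twos zero 0 _ (s≤s (s≤s ()))
pos-three-twos m (suc (suc _)) (s≤s ()) _

-- Reversal and degrees

M-++ : ∀ r (g : Fn) xs ys → M r g (xs ++ ys) ≡ M r (λ x → g (x ++ ys)) xs + M r (λ y → g (xs ++ y)) ys
M-++ r g [] ys = refl
M-++ r g (a ∷ xs) ys = begin
  M r g (a ∷ xs ++ ys) ≡⟨ M-∷ r g a (xs ++ ys) ⟩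
  l + M r (g ∘ (a ∷_)) (xs ++ ys) ≡⟨ cong (l +_) (M-++ r (g ∘ (a ∷_)) xs ys) ⟩
  l + (M r (λ x → g (a ∷ x ++ ys)) xs + M r (λ y → g (a ∷ xs ++ y)) ys) ≡⟨ +-assoc l _ _ ⟨
  (l + M r (λ x → g (a ∷ x ++ ys)) xs) + M r (λ y → g (a ∷ xs ++ y)) ys
    ≡⟨ cong (_+ M r (λ y → g (a ∷ xs ++ y)) ys) (M-∷ r (λ x → g (x ++ ys)) a xs) ⟨
  M r (λ x → g (x ++ ys)) (a ∷ xs) + M r (λ y → g (a ∷ xs ++ y)) ys ∎
  where l = lower r a (λ a′ → g (a′ ∷ xs ++ ys))

M-reverse : ∀ r (g : Fn) β → M r g (reverse β) ≡ M r (g ∘ reverse) β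
M-reverse r g [] = refl
M-reverse r g (a ∷ β) = begin
  M r g (reverse (a ∷ β)) ≡⟨ cong (M r g) (unfold-reverse a β) ⟩
  M r g (reverse β ++ [ a ]) ≡⟨ M-++ r g (reverse β) [ a ] ⟩
  M r (λ x → g (x ++ [ a ])) (reverse β) + M r (λ y → g (reverse β ++ y)) [ a ]
    ≡⟨ cong₂ _+_ (M-reverse r (λ x → g (x ++ [ a ])) β) (trans (M-∷ r (λ y → g (reverse β ++ y)) a []) (+-identityʳ _)) ⟩
  M r (λ x → g (reverse x ++ [ a ])) β + lower r a (λ a′ → g (reverse β ++ [ a′ ])) ≡⟨ +-comm (M r (λ x → g (reverse x ++ [ a ])) β) _ ⟩
  lower r a (λ a′ → g (reverse β ++ [ a′ ])) + M r (λ x → g (reverse x ++ [ a ])) β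
    ≡⟨ cong₂ _+_ (cong (λ x → gate (r ≤ᵇ a) (g x)) (unfold-reverse (a ∸ r) β))
         (op-cong (decrs r) (λ x → cong g (unfold-reverse a x)) β) ⟨
  lower r a (λ a′ → g (reverse (a′ ∷ β))) + M r (λ x → g (reverse (a ∷ x))) β ≡⟨ M-∷ r (g ∘ reverse) a β ⟨
  M r (g ∘ reverse) (a ∷ β) ∎

sum-reverse : ∀ β → sum (reverse β) ≡ sum β
sum-reverse [] = refl
sum-reverse (a ∷ β) = begin
  sum (reverse (a ∷ β)) ≡⟨ cong sum (unfold-reverse a β) ⟩
  sum (reverse β ++ [ a ]) ≡⟨ sum-++ (reverse β) [ a ] ⟩
  sum (reverse β) + (a + 0) ≡⟨ cong₂ _+_ (sum-reverse β) (+-identityʳ a) ⟩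
  sum β + a ≡⟨ +-comm (sum β) a ⟩
  a + sum β ∎

-- `kostka` reverses the exponent vector before peeling and `pcoef` reads it forwards; this symmetry
-- reconciles the two.
pcoef-reverse : ∀ lam β → pcoef lam (reverse β) ≡ pcoef lam β
pcoef-reverse [] β = cong (λ s → if s ≡ᵇ 0 then 1 else 0) (sum-reverse β)
pcoef-reverse (r ∷ lam) β = trans (M-reverse r (pcoef lam) β) (op-cong (decrs r) (pcoef-reverse lam) β)

decrs-sum : ∀ {γ} r β → γ ∈ decrs r β → r + sum γ ≡ sum β
decrs-sum r (a ∷ β) γ∈ with r ≤ᵇ a in e
decrs-sum r (a ∷ β) (here refl) | true = trans (sym (+-assoc r (a ∸ r) (sum β))) (cong (_+ sum β) (m+[n∸m]≡n (≤ᵇ≡true⇒≤ {r} e)))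
decrs-sum r (a ∷ β) (there γ∈) | true = below γ∈
  where
  below : ∀ {γ} → γ ∈ map (a ∷_) (decrs r β) → r + sum γ ≡ sum (a ∷ β)
  below γ∈ with ∈-map⁻ (a ∷_) γ∈
  ... | γ′ , γ′∈ , refl = trans (x∙yz≈y∙xz r a (sum γ′)) (cong (a +_) (decrs-sum r β γ′∈))
decrs-sum r (a ∷ β) γ∈ | false with ∈-map⁻ (a ∷_) γ∈
... | γ′ , γ′∈ , refl = trans (x∙yz≈y∙xz r a (sum γ′)) (cong (a +_) (decrs-sum r β γ′∈))

pcoef-degree : ∀ lam β → ¬ (sum β ≡ sum lam) → pcoef lam β ≡ 0
pcoef-degree [] β ≢ = cong (λ b → if b then 1 else 0) (≢⇒≡ᵇ≡false ≢)
pcoef-degree (r ∷ lam) β ≢ = ∑-zero (decrs r β) (λ γ γ∈ →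
  pcoef-degree lam γ (λ e → ≢ (trans (sym (decrs-sum r β γ∈)) (cong (r +_) e))))

K′-degree : ∀ ν β → ¬ (sum ν ≡ sum β) → K′ ν β ≡ 0
K′-degree ν [] ≢ = cong (λ b → if b then 1 else 0) (≢⇒≡ᵇ≡false ≢)
K′-degree ν (a ∷ β) ≢ = ∑-zero (interl ν) (λ κ _ → term κ)
  where
  term : ∀ κ → gate (sum ν ≡ᵇ sum κ + a) (K′ κ β) ≡ 0
  term κ with sum ν ≡ᵇ sum κ + a in e
  ... | false = refl
  ... | true = K′-degree κ β (λ q → ≢ (trans (≡ᵇ⇒≡ (sum ν) (sum κ + a) (subst T (sym e) tt))
    (trans (+-comm (sum κ) a) (cong (a +_) q))))

-- Enumeration of partitions

data Part : ℕ → ℕ → List ℕ → Set where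
  nil : ∀ {m} → Part m 0 []
  cons : ∀ {m n y k} → suc k ≤ m → Part (suc k) n y → Part m (suc k + n) (suc k ∷ y)

part-weaken : ∀ {m m′ n y} → m ≤ m′ → Part m n y → Part m′ n y
part-weaken m≤ nil = nil
part-weaken m≤ (cons k≤ p) = cons (≤-trans k≤ m≤) p

part-sum : ∀ {m n y} → Part m n y → sum y ≡ n
part-sum nil = refl
part-sum (cons {k = k} _ p) = cong (suc k +_) (part-sum p)

part-dropZeros : ∀ {m n y} → Part m n y → dropZeros y ≡ y
part-dropZeros nil = refl
part-dropZeros (cons {k = k} _ p) = cong (suc k ∷_) (part-dropZeros p)

part-dec : ∀ {m n y} → Part m n y → dec y ≡ true
part-dec nil = refl
part-dec (cons _ nil) = refl
part-dec (cons _ p@(cons {y = y} k≤ _)) = dec-∷ {l = y} k≤ (part-dec p)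

toPart : ∀ m y → dec (m ∷ y) ≡ true → All (1 ≤_) y → Part m (sum y) y
toPart m [] d [] = nil
toPart m (suc k ∷ y) d (_ ∷ pos) = cons (dec-head m (suc k) y d) (toPart (suc k) y (dec-tail m (suc k ∷ y) d) pos)

dropZeros-pos : ∀ x → All (1 ≤_) (dropZeros x)
dropZeros-pos [] = []
dropZeros-pos (zero ∷ x) = dropZeros-pos x
dropZeros-pos (suc a ∷ x) = s≤s z≤n ∷ dropZeros-pos x

sum-bounds : ∀ y → dec y ≡ true → dec (sum y ∷ y) ≡ true
sum-bounds [] d = refl
sum-bounds (a ∷ y) d = dec-∷ {l = y} (m≤m+n a (sum y)) d

decreasing⇒part : ∀ y → dec y ≡ true → All (1 ≤_) y → Part (sum y) (sum y) y
decreasing⇒part y d pos = toPart (sum y) y (sum-bounds y d) pos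

∑-range-single : ∀ {b a} j (h : ℕ → ℕ) → b ≤ j → j ≤ a → ∑ (λ k → gate (j ≡ᵇ k) (h k)) (range b a) ≡ h j
∑-range-single {b} {zero} zero h z≤n z≤n = +-identityʳ (h 0)
∑-range-single {b} {suc a} j h b≤j j≤1+a with m≤n⇒m<n∨m≡n j≤1+a
... | inj₁ (s≤s j≤a) = begin
  ∑ (λ k → gate (j ≡ᵇ k) (h k)) (range b (suc a)) ≡⟨ ∑-range-last _ (≤-trans b≤j j≤1+a) ⟩
  ∑ (λ k → gate (j ≡ᵇ k) (h k)) (range b a) + gate (j ≡ᵇ suc a) (h (suc a))
    ≡⟨ cong₂ _+_ (∑-range-single j h b≤j j≤a) (cong (λ t → gate t (h (suc a))) (≢⇒≡ᵇ≡false (<⇒≢ (s≤s j≤a)))) ⟩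
  h j + 0 ≡⟨ +-identityʳ (h j) ⟩
  h j ∎
... | inj₂ refl = begin
  ∑ (λ k → gate (suc a ≡ᵇ k) (h k)) (range b (suc a)) ≡⟨ ∑-range-last _ b≤j ⟩
  ∑ (λ k → gate (suc a ≡ᵇ k) (h k)) (range b a) + gate (suc a ≡ᵇ suc a) (h (suc a))
    ≡⟨ cong₂ _+_
         (∑-zero (range b a) (λ k k∈ → cong (λ t → gate t (h k))
           (≢⇒≡ᵇ≡false {suc a} {k} (λ e → <⇒≢ (s≤s (proj₂ (∈-range b a k∈))) (sym e)))))
         (cong (λ t → gate t (h (suc a))) (≡⇒≡ᵇ≡true {suc a} refl)) ⟩
  h (suc a) ∎

gate-∧ : ∀ x y m → gate (x ∧ y) m ≡ gate x (gate y m)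
gate-∧ true y m = refl
gate-∧ false y m = refl

gate-comm : ∀ x y m → gate x (gate y m) ≡ gate y (gate x m)
gate-comm true true m = refl
gate-comm true false m = refl
gate-comm false true m = refl
gate-comm false false m = refl

-- Every partition occurs exactly once in the enumeration.
∑-parts-single : ∀ {fuel m n y} (F : Fn) → Part m n y → n ≤ fuel →
  ∑ (λ ν → gate (eqL y ν) (F ν)) (parts fuel m n) ≡ F y
∑-parts-single F nil _ = +-identityʳ (F [])
∑-parts-single {suc fuel} {m} F (cons {n = n} {y} {k} k≤m p) (s≤s n≤) = begin
  ∑ (λ ν → gate (eqL (suc k ∷ y) ν) (F ν)) (concatMap sub (filterᵇ (λ j → j ≤ᵇ N) (range 1 m)))
    ≡⟨ ∑-concatMap _ sub (filterᵇ (λ j → j ≤ᵇ N) (range 1 m)) ⟩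
  ∑ (λ j → ∑ (λ ν → gate (eqL (suc k ∷ y) ν) (F ν)) (sub j)) (filterᵇ (λ j → j ≤ᵇ N) (range 1 m))
    ≡⟨ ∑-filterᵇ _ (λ j → j ≤ᵇ N) (range 1 m) ⟩
  ∑ (λ j → gate (j ≤ᵇ N) (∑ (λ ν → gate (eqL (suc k ∷ y) ν) (F ν)) (sub j))) (range 1 m)
    ≡⟨ ∑-cong (range 1 m) (λ j → trans (cong (gate (j ≤ᵇ N)) (inner j)) (gate-comm (j ≤ᵇ N) (suc k ≡ᵇ j) _)) ⟩
  ∑ (λ j → gate (suc k ≡ᵇ j) (gate (j ≤ᵇ N) (∑ (λ ν → gate (eqL y ν) (F (j ∷ ν))) (parts fuel j (N ∸ j))))) (range 1 m)
    ≡⟨ ∑-range-single (suc k) _ (s≤s z≤n) k≤m ⟩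
  gate (suc k ≤ᵇ N) (∑ (λ ν → gate (eqL y ν) (F (suc k ∷ ν))) (parts fuel (suc k) (k + n ∸ k)))
    ≡⟨ cong₂ (λ b t → gate b (∑ (λ ν → gate (eqL y ν) (F (suc k ∷ ν))) (parts fuel (suc k) t)))
         (≤⇒≤ᵇ≡true (m≤m+n (suc k) n)) (m+n∸m≡n k n) ⟩
  ∑ (λ ν → gate (eqL y ν) (F (suc k ∷ ν))) (parts fuel (suc k) n)
    ≡⟨ ∑-parts-single (F ∘ (suc k ∷_)) p (≤-trans (m≤n+m n k) n≤) ⟩
  F (suc k ∷ y) ∎
  where
  N = suc k + n
  sub : ℕ → List (List ℕ)
  sub j = map (j ∷_) (parts fuel j (N ∸ j))
  inner : ∀ j → ∑ (λ ν → gate (eqL (suc k ∷ y) ν) (F ν)) (sub j) ≡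
    gate (suc k ≡ᵇ j) (∑ (λ ν → gate (eqL y ν) (F (j ∷ ν))) (parts fuel j (N ∸ j)))
  inner j = trans (∑-map _ (j ∷_) (parts fuel j (N ∸ j)))
    (trans (∑-cong (parts fuel j (N ∸ j)) (λ ν → gate-∧ (suc k ≡ᵇ j) (eqL y ν) (F (j ∷ ν))))
      (∑-gate (suc k ≡ᵇ j) _ (parts fuel j (N ∸ j))))

∈-parts : ∀ {ν} fuel m n → ν ∈ parts fuel m n → Part m n ν
∈-parts zero m zero (here refl) = nil
∈-parts (suc fuel) m zero (here refl) = nil
∈-parts (suc fuel) m N@(suc n) ν∈
  with find (∈-concatMap⁻ (λ k → map (k ∷_) (parts fuel k (N ∸ k))) {xs = filterᵇ (λ k → k ≤ᵇ N) (range 1 m)} ν∈)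
... | k , k∈ , ν∈′ with ∈-filterᵇ (λ k → k ≤ᵇ N) (range 1 m) k∈ | ∈-map⁻ (k ∷_) ν∈′
... | k∈′ , k≤N | ν′ , ν′∈ , refl with ∈-range 1 m k∈′
∈-parts (suc fuel) m (suc n) ν∈ | suc k , k∈ , ν∈′ | k∈′ , k≤N | ν′ , ν′∈ , refl | _ , k≤m =
  subst (λ t → Part m t (suc k ∷ ν′)) (m+[n∸m]≡n (≤ᵇ≡true⇒≤ {suc k} k≤N))
    (cons k≤m (∈-parts fuel (suc k) (n ∸ k) ν′∈))

-- From multisets of partitions to coefficients

multiplicity : List (List ℕ) → Fn
multiplicity ys ν = ∑ (λ y → gate (eqL y ν) 1) ys

-- Exchanging the sums leaves, for each `y`, a sum over all partitions of `n`, among which `y`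
-- occurs exactly once.
∑-multiplicity : ∀ n ys → (∀ y → y ∈ ys → Part n n y) → (F : Fn) →
  ∑ (λ ν → multiplicity ys ν * F ν) (partitions n) ≡ ∑ F ys
∑-multiplicity n ys valid F = begin
  ∑ (λ ν → multiplicity ys ν * F ν) (partitions n)
    ≡⟨ ∑-cong (partitions n) (λ ν → trans (sym (∑-*ʳ (λ y → gate (eqL y ν) 1) (F ν) ys)) (∑-cong ys (λ y → gate-* (eqL y ν) (F ν)))) ⟩
  ∑ (λ ν → ∑ (λ y → gate (eqL y ν) (F ν)) ys) (partitions n) ≡⟨ ∑-swap _ (partitions n) ys ⟩
  ∑ (λ y → ∑ (λ ν → gate (eqL y ν) (F ν)) (partitions n)) ys
    ≡⟨ ∑-cong-∈ ys (λ y y∈ → ∑-parts-single F (valid y y∈) ≤-refl) ⟩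
  ∑ F ys ∎
  where
  gate-* : ∀ b m → gate b 1 * m ≡ gate b m
  gate-* true m = +-identityʳ m
  gate-* false m = refl

-- Comparing multiplicities settles membership and repetitions at once.
∑-select : ∀ n ys (p : List ℕ → Bool) → (∀ y → y ∈ ys → Part n n y) →
  (∀ ν → Part n n ν → gate (p ν) 1 ≡ multiplicity ys ν) → (F : Fn) →
  ∑ F (filterᵇ p (partitions n)) ≡ ∑ F ys
∑-select n ys p valid agree F = begin
  ∑ F (filterᵇ p (partitions n)) ≡⟨ ∑-filterᵇ F p (partitions n) ⟩
  ∑ (λ ν → gate (p ν) (F ν)) (partitions n)
    ≡⟨ ∑-cong-∈ (partitions n) (λ ν ν∈ → trans (gate-1 (p ν) (F ν)) (cong (_* F ν) (agree ν (∈-parts n n n ν∈)))) ⟩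
  ∑ (λ ν → multiplicity ys ν * F ν) (partitions n) ≡⟨ ∑-multiplicity n ys valid F ⟩
  ∑ F ys ∎
  where
  gate-1 : ∀ b m → gate b m ≡ gate b 1 * m
  gate-1 true m = sym (+-identityʳ m)
  gate-1 false m = refl

-- The list behind `Pos` may contain shapes of any degree. Keeping those of degree `n` is harmless:
-- in other degrees both sides vanish. The Schur coefficients are the multiplicities in the trimmed
-- list.
pos⇒SchurPositive : ∀ n (ys : List (List ℕ)) → (∀ y → y ∈ ys → Part n n y) →
  Pos (λ β → ∑ (λ lam → pcoef lam β) ys) → (f : Fn) → (∀ α → f α ≡ ∑ (λ lam → pcoef lam α) ys) →
  SchurPositive n f
pos⇒SchurPositive n ys valid (xs , r) f f≡ = multiplicity zs , λ (α , _) → begin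
  f α ≡⟨ f≡ α ⟩
  ∑ (λ lam → pcoef lam α) ys ≡⟨ ∑-cong ys (λ lam → pcoef-reverse lam α) ⟨
  P (reverse α) ≡⟨ restrict (reverse α) ⟩
  KL zs (reverse α) ≡⟨ ∑-cong-∈ zs (λ z z∈ → kostka-K′ z (zs-part z z∈) (reverse α)) ⟨
  ∑ (λ z → kostka z α) zs ≡⟨ ∑-multiplicity n zs zs-part (λ ν → kostka ν α) ⟨
  ∑ (λ ν → multiplicity zs ν * kostka ν α) (partitions n) ∎
  where
  P : Fn
  P β = ∑ (λ lam → pcoef lam β) ys
  zs = filterᵇ (λ ν → sum ν ≡ᵇ n) (trim xs)
  zs-part : ∀ z → z ∈ zs → Part n n z
  zs-part z z∈ with ∈-filterᵇ (λ ν → sum ν ≡ᵇ n) (trim xs) z∈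
  ... | z∈′ , s with ∈-map⁻ dropZeros z∈′
  ... | x , x∈ , refl = subst (λ t → Part t t (dropZeros x)) (≡ᵇ⇒≡ (sum (dropZeros x)) n (subst T (sym s) tt))
    (decreasing⇒part (dropZeros x) (dropZeros-dec x (proj₂ (∈-filterᵇ dec xs x∈))) (dropZeros-pos x))
  kostka-K′ : ∀ z → Part n n z → ∀ β → kostkaRev z β ≡ K′ z β
  kostka-K′ z p β = trans (cong (λ t → kostkaRev t β) (sym (part-dropZeros p))) (kostkaRev≡K′ β z (part-dec p))
  restrict : P ≗ KL zs
  restrict β with sum β ≟ n
  ... | yes e = trans (r β) (trans (KL-trim xs β)
    (trans (∑-cong (trim xs) term) (sym (∑-filterᵇ (λ ν → K′ ν β) (λ ν → sum ν ≡ᵇ n) (trim xs)))))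
    where
    term : ∀ ν → K′ ν β ≡ gate (sum ν ≡ᵇ n) (K′ ν β)
    term ν with sum ν ≡ᵇ n in q
    ... | true = refl
    ... | false = K′-degree ν β (λ e′ → case-false (trans (sym q) (≡⇒≡ᵇ≡true (trans e′ e))))
      where
      case-false : ¬ (false ≡ true)
      case-false ()
  ... | no ≢ = trans (∑-zero ys (λ y y∈ → pcoef-degree y β (λ e → ≢ (trans e (part-sum (valid y y∈))))))
    (sym (∑-zero zs (λ z z∈ → K′-degree z β (λ e → ≢ (trans (sym e) (part-sum (zs-part z z∈)))))))

-- The interval below (3, 1^{n-3})

eqL-refl : ∀ x → eqL x x ≡ true
eqL-refl [] = refl
eqL-refl (a ∷ x) rewrite ≡⇒≡ᵇ≡true {a} refl = eqL-refl x

part-1s : ∀ n → Part 1 n (replicate n 1)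
part-1s zero = nil
part-1s (suc n) = cons ≤-refl (part-1s n)

part-1-unique : ∀ {n y} → Part 1 n y → y ≡ replicate n 1
part-1-unique nil = refl
part-1-unique (cons {k = zero} _ p) = cong (1 ∷_) (part-1-unique p)
part-1-unique (cons {k = suc k} (s≤s ()) p)

oneN-min : ∀ {m n ν} → Part m n ν → leqRL (oneN n) ν ≡ true
oneN-min nil = refl
oneN-min (cons {k = zero} _ p) = oneN-min p
oneN-min (cons {k = suc k} _ p) = refl

leqRL-1s : ∀ {m n ν} → Part m n ν → leqRL ν (replicate n 1) ≡ eqL (replicate n 1) ν
leqRL-1s nil = refl
leqRL-1s (cons {k = zero} _ p) = leqRL-1s p
leqRL-1s (cons {k = suc k} _ p) = refl

twosOnes : ℕ → ℕ → List ℕ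
twosOnes k j = replicate k 2 ++ replicate j 1

-- By the first part of `ν`: 1 forces all parts 1, the head of `twos`; 2 can be removed from both
-- sides; anything larger exceeds the bound.
below-twos : ∀ k j {m n ν} → Part m n ν → n ≡ k * 2 + j →
  gate (leqRL ν (twosOnes k j)) 1 ≡ multiplicity (twos k j) ν
below-twos zero j {ν = ν} p refl = trans (cong (λ b → gate b 1) (leqRL-1s p)) (sym (+-identityʳ _))
below-twos (suc k) j (cons {y = y} {k = zero} _ p) e = sym (cong₂ _+_
  (cong (λ b → gate b 1) (trans (cong (eqL (replicate (suc (k * 2 + j)) 1)) y≡) (eqL-refl (replicate (suc (k * 2 + j)) 1))))
  (trans (∑-map (λ z → gate (eqL z (1 ∷ y)) 1) (2 ∷_) (twos k j)) (∑-0 (twos k j))))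
  where
  y≡ : y ≡ replicate (suc (k * 2 + j)) 1
  y≡ = trans (part-1-unique p) (cong (λ t → replicate t 1) (suc-injective e))
below-twos (suc k) j (cons {y = y} {k = 1} _ p) e = begin
  gate (leqRL y (twosOnes k j)) 1 ≡⟨ below-twos k j p (suc-injective (suc-injective e)) ⟩
  multiplicity (twos k j) y ≡⟨ ∑-map (λ z → gate (eqL z (2 ∷ y)) 1) (2 ∷_) (twos k j) ⟨
  ∑ (λ z → gate (eqL z (2 ∷ y)) 1) (map (2 ∷_) (twos k j)) ∎
below-twos (suc k) j (cons {y = y} {k = suc (suc i)} _ p) e =
  sym (trans (∑-map (λ z → gate (eqL z (suc (suc (suc i)) ∷ y)) 1) (2 ∷_) (twos k j)) (∑-0 (twos k j)))

-- With `j ≤ 1` no two parts 1 are left to merge. This makes `twosOnes k j` the predecessor of (3,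
-- 1^{n-3}) in the order.
max-twos : ∀ k j {n ν} → j ≤ 1 → Part 2 n ν → n ≡ k * 2 + j → leqRL ν (twosOnes k j) ≡ true
max-twos k j _ nil e = refl
max-twos zero 1 _ (cons {k = zero} _ nil) e = refl
max-twos zero (suc (suc j)) (s≤s ()) (cons _ p) e
max-twos (suc k) j _ (cons {k = zero} _ p) e = refl
max-twos (suc k) j j≤1 (cons {k = 1} _ p) e = max-twos k j j≤1 p (suc-injective (suc-injective e))
max-twos _ j _ (cons {k = suc (suc _)} (s≤s (s≤s ())) p) e

below-three : ∀ k j {m n ν} → j ≤ 1 → Part m n ν → n ≡ suc k * 2 + j →
  gate (leqRL ν (threeOnes n)) 1 ≡ multiplicity (threeOnes n ∷ twos (suc k) j) ν
below-three k j {n = n} {ν} j≤1 p e =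
  trans (cases p e) (cong (gate (eqL (threeOnes n) ν) 1 +_) (below-twos (suc k) j p e))
  where
  cases : ∀ {m n ν} → Part m n ν → n ≡ suc k * 2 + j →
    gate (leqRL ν (threeOnes n)) 1 ≡ gate (eqL (threeOnes n) ν) 1 + gate (leqRL ν (twosOnes (suc k) j)) 1
  cases (cons {k = 0} _ p) e = refl
  cases (cons {k = 1} _ p) e = cong (λ b → gate b 1) (sym (max-twos k j j≤1 p (suc-injective (suc-injective e))))
  cases (cons {k = 2} _ p) e = trans (cong (λ b → gate b 1) (leqRL-1s p)) (sym (+-identityʳ _))
  cases (cons {k = suc (suc (suc _))} _ p) e = refl

twos-part : ∀ k j y → y ∈ twos k j → Part 2 (k * 2 + j) y
twos-part zero j y (here refl) = part-weaken (s≤s z≤n) (part-1s j)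
twos-part (suc k) j y (here refl) = part-weaken (s≤s z≤n) (part-1s (suc k * 2 + j))
twos-part (suc k) j y (there y∈) with ∈-map⁻ (2 ∷_) y∈
... | y′ , y′∈ , refl = cons ≤-refl (twos-part k j y′ y′∈)

part-2-shape : ∀ {n y} → Part 2 n y → ∃ λ k → ∃ λ j → (y ≡ twosOnes k j) × (n ≡ k * 2 + j)
part-2-shape nil = 0 , 0 , refl , refl
part-2-shape (cons {n = n} {k = 0} _ p) = 0 , suc n , cong (1 ∷_) (part-1-unique p) , refl
part-2-shape (cons {k = 1} _ p) with part-2-shape p
... | k , j , refl , refl = suc k , j , refl , refl
part-2-shape (cons {k = suc (suc _)} (s≤s (s≤s ())) p)

below-three-shape : ∀ {m n μ} → 3 ≤ n → Part m n μ → leqRL μ (threeOnes n) ≡ true →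
  (μ ≡ threeOnes n) ⊎ (∃ λ k → ∃ λ j → (μ ≡ twosOnes k j) × (n ≡ k * 2 + j))
below-three-shape 3≤n (cons {k = 0} _ p) le = inj₂ (part-2-shape (cons (s≤s z≤n) p))
below-three-shape 3≤n (cons {k = 1} _ p) le = inj₂ (part-2-shape (cons ≤-refl p))
below-three-shape 3≤n (cons {n = n} {y} {k = 2} _ p) le =
  inj₁ (cong (3 ∷_) (sym (eqL-sound (replicate n 1) y (trans (sym (leqRL-1s p)) le))))

halve : ∀ n → ∃ λ k → ∃ λ j → (n ≡ k * 2 + j) × (j ≤ 1)
halve 0 = 0 , 0 , refl , z≤n
halve 1 = 0 , 1 , refl , ≤-refl
halve (suc (suc n)) with halve n
... | k , j , refl , j≤1 = suc k , j , refl , j≤1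

-- The Dec≥ local to IsPartition ignores the n and μ it is lifted over,
-- so the recursive call may replace them.
partition⇒dec : ∀ n μ → IsPartition n μ → dec μ ≡ true
partition⇒dec n [] _ = refl
partition⇒dec n (a ∷ []) _ = refl
partition⇒dec n (zero ∷ b ∷ l) (_ , z , _) with subst (All (1 ≤_)) z (dropZeros-pos (zero ∷ b ∷ l))
... | () ∷ _
partition⇒dec n (suc a ∷ l@(b ∷ _)) (_ , z , d) =
  cong₂ _∧_ (proj₁ (∧-true {b ≤ᵇ suc a} d))
    (partition⇒dec (sum l) l (refl , ∷-injectiveʳ z , proj₂ (∧-true {b ≤ᵇ suc a} d)))

partition⇒part : ∀ n μ → IsPartition n μ → Part n n μ
partition⇒part n μ isP@(refl , z , _) =
  decreasing⇒part μ (partition⇒dec n μ isP) (subst (All (1 ≤_)) z (dropZeros-pos μ))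

psi-positive : ∀ n μ ys → (∀ y → y ∈ ys → Part n n y) →
  (∀ ν → Part n n ν → gate (leqRL ν μ) 1 ≡ multiplicity ys ν) →
  Pos (λ β → ∑ (λ lam → pcoef lam β) ys) → SchurPositive n (psiCoef n μ)
psi-positive n μ ys valid agree pos = pos⇒SchurPositive n ys valid pos (psiCoef n μ)
  (λ α → ∑-select n ys (λ lam → leqRL (oneN n) lam ∧ leqRL lam μ) valid
    (λ ν p → trans (cong (λ b → gate (b ∧ leqRL ν μ) 1) (oneN-min p)) (agree ν p)) (λ lam → pcoef lam α))

theorem2p11 : (n : ℕ) → 3 ≤ n → (μ : List ℕ) → IsPartition n μ →
    leqRL (oneN n) μ ≡ true → leqRL μ (threeOnes n) ≡ true →
    SchurPositive n (psiCoef n μ)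
theorem2p11 n 3≤n μ isP _ le with below-three-shape 3≤n (partition⇒part n μ isP) le
... | inj₂ (k , j , refl , refl) = psi-positive n μ (twos k j)
  (λ y y∈ → part-weaken (≤-trans (s≤s (s≤s z≤n)) 3≤n) (twos-part k j y y∈))
  (λ ν p → below-twos k j p refl) (pos-twos k j)
-- Every (2^i, 1^{n-2i}) lies below (3, 1^{n-3}), so the sum must run up to the integer half of `n`,
-- which is positive by `3 ≤ n`.
... | inj₁ refl with halve n
... | zero , j , refl , j≤1 = contradiction (≤-trans 3≤n j≤1) (<⇒≱ (s≤s (s≤s z≤n)))
... | suc k , j , refl , j≤1 = psi-positive n μ (threeOnes n ∷ twos (suc k) j) valid
  (λ ν p → below-three k j j≤1 p refl) (pos-three-twos k j j≤1 3≤n)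
  where
  valid : ∀ y → y ∈ threeOnes (suc k * 2 + j) ∷ twos (suc k) j → Part (suc k * 2 + j) (suc k * 2 + j) y
  valid _ (here refl) = subst (λ t → Part (suc k * 2 + j) t (threeOnes (suc k * 2 + j))) (m+[n∸m]≡n 3≤n)
    (cons 3≤n (part-weaken (s≤s z≤n) (part-1s (suc k * 2 + j ∸ 3))))
  valid y (there y∈) = part-weaken (≤-trans (s≤s (s≤s z≤n)) 3≤n) (twos-part (suc k) j y y∈)
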